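{- Let $q,n,d$ be positive integers with $d\le n$ and $q\ge2$. Then $$ A_q(n,d)\ \ge\ \frac{q^n}{V_q(n,d-1)}\cdot\frac{\log_2 V_q(n,d-1)-\log_2\sqrt{e_q(n,d-1)}}{10}, $$ where $V_q$ and $e_q$ are as defined in the context.
   Context: $A_q(n,d)$ is the maximum number of codewords in a code of length $n$ and minimum Hamming distance $d$ over an alphabet of $q$ letters. $V_q(n,r)=\sum_{i=0}^{r}\binom{n}{i}(q-1)^i$. For positive integers $r\le n$, $$ e_q(n,r)=\frac16\sum_{w=1}^{r}\sum_{i=1}^{r}\sum_{j=0}^{a}\sum_{k=b}^{a-j}\frac{n!\,(q-2)^k(q-1)^{w+i-c}}{j!\,k!\,(w-c)!\,(i-c)!\,(n+c-w-i)!}\;-\;\frac{V_q(n,r)-1}{6}, $$ where $a=\min\{w,i\}$, $c=j+k$, and $b$ is the smallest nonnegative integer greater than or equal to $(w+i)-j-\min\{r+j,n\}$ (with the convention $0^0=1$ when $q=2$).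
   Formalization: The formal theorem assumes e_q(n,d-1) > 0, which excludes exactly d = 1 and the case q = 2, d = 2, where e_q(n,d-1) is undefined or zero and log_2 sqrt(e_q(n,d-1)) has no meaning; the logarithmic bound is stated in equivalent exponentiated form. -}

module Defs where

open import Data.Nat as ℕ using (ℕ; zero; suc; _+_; _*_; _∸_; _^_; _≤_; _!; _⊓_; NonZero)
open import Data.Nat.Properties using (_!≢0; m*n≢0)
open import Data.Nat.DivMod using (_/_)
open import Data.Nat.Combinatorics using (_C_)
open import Data.Integer as ℤ using (ℤ; +_)
open import Data.Rational as ℚ using (ℚ)
open import Data.Fin using (Fin)
open import Data.Vec using (Vec; []; _∷_)
open import Data.List using (List; []; _∷_; upTo; map)
open import Data.Nat.ListAction using (sum)
open import Data.List.Relation.Unary.AllPairs using (AllPairs)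
open import Relation.Nullary.Decidable using (does)
open import Data.Bool using (if_then_else_)
open import Data.Fin.Properties using () renaming (_≟_ to _≟F_)

hamming : ∀ {q n} → Vec (Fin q) n → Vec (Fin q) n → ℕ
hamming []       []       = 0
hamming (x ∷ xs) (y ∷ ys) = (if does (x ≟F y) then 0 else 1) + hamming xs ys

IsCode : (q n d : ℕ) → List (Vec (Fin q) n) → Set
IsCode q n d C = AllPairs (λ x y → d ≤ hamming x y) C

V : ℕ → ℕ → ℕ → ℕ
V q n r = sum (map (λ i → (n C i) * (q ∸ 1) ^ i) (upTo (suc r)))

-- Σ_{x = lo}^{hi} f x  (empty if hi < lo)
Σ[_to_] : ℕ → ℕ → (ℕ → ℕ) → ℕ
Σ[ lo to hi ] f = sum (map (λ t → f (lo + t)) (upTo (suc hi ∸ lo)))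

multinom : ℕ → ℕ → ℕ → ℕ → ℕ → ℕ → ℕ
multinom n a b c d e =
  (n ! / ((a ! * b !) * (c ! * (d ! * e !))))
    {{m*n≢0 _ _ {{m*n≢0 _ _ {{a !≢0}} {{b !≢0}}}}
                {{m*n≢0 _ _ {{c !≢0}} {{m*n≢0 _ _ {{d !≢0}} {{e !≢0}}}}}}}}

eSum : ℕ → ℕ → ℕ → ℕ
eSum q n r =
  Σ[ 1 to r ] λ w →
  Σ[ 1 to r ] λ i →
  let a = w ⊓ i in
  Σ[ 0 to a ] λ j →
  let b = (w + i) ∸ (j + ((r + j) ⊓ n)) in
  Σ[ b to a ∸ j ] λ k →
  let c = j + k in
  multinom n j k (w ∸ c) (i ∸ c) ((n + c) ∸ (w + i))
    * (q ∸ 2) ^ k * (q ∸ 1) ^ ((w + i) ∸ c)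

e : ℕ → ℕ → ℕ → ℚ
e q n r = (+ eSum q n r ℚ./ 6) ℚ.- ((+ V q n r ℤ.- ℤ.1ℤ) ℚ./ 6)

_^ℚ_ : ℚ → ℕ → ℚ
x ^ℚ zero  = ℚ.1ℚ
x ^ℚ suc k = x ℚ.* (x ^ℚ k)

ℕ→ℚ : ℕ → ℚ
ℕ→ℚ m = + m ℚ./ 1

{-# OPTIONS --safe #-}

-- Join two words when their distance is at most r = d − 1, write D = V q n r, and let
-- P = eSum q n r − (D − 1), which is six times e q n r, bound the number of ordered adjacent pairs
-- in the neighbourhood of a word.  Draw a random code I from the hard-core model at fugacity
-- 1 / m with P ≤ m² ≤ 2 P.  Condition on I outside the closed neighbourhood of v, and suppose that
-- h neighbours of v remain available.  If h is large then I contains many neighbours of v on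
-- average, because the h available words span few edges; if h is small then the partition
-- function of the available words is at most (1 + 1/m) ^ h, and v itself lies in I with large
-- probability.  Either way D · [v ∈ I] + 2 · |I ∩ N[v]| has mean at least s, where s is about
-- 3/20 of log₂ (D² / e).  Summing over all v gives 3 D |I| on one side and qⁿ s on the other.
-- When log₂ (D² / e) ≤ 20 the Gilbert–Varshamov bound suffices.
module Submission where

open import Defs
open import Data.Nat
open import Data.Fin using (Fin; zero; suc)
open import Data.Vec using (Vec; []; _∷_)
open import Data.List using (List; []; _∷_; _++_; length; map; filterᵇ; allFin; upTo; cartesianProductWith)
open import Data.Product using (∃-syntax; _×_; _,_; map₂)
open import Data.Rational as ℚ using (ℚ; 0ℚ)
open import Algebra.Bundles using (CommutativeMonoid)
open import Data.Bool using (Bool; true; false; _∧_; not; if_then_else_; T)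
open import Data.Bool.Properties using (∧-zeroʳ)
open import Data.Fin.Properties using () renaming (_≟_ to _≟F_)
import Data.Integer as ℤ
import Data.Integer.Properties as ℤ
import Data.Integer.Tactic.RingSolver as ℤ-Solver
open import Data.List.Properties using (map-++; map-tabulate; map-applyUpTo; map-cong; map-∘)
open import Data.List.Relation.Binary.Permutation.Propositional as ↭ using (_↭_; ↭-sym)
open import Data.List.Relation.Binary.Permutation.Propositional.Properties using (map⁺; shift; ++-comm)
open import Data.List.Relation.Unary.All as All using (All; []; _∷_)
open import Data.List.Relation.Unary.AllPairs as AllPairs using (AllPairs; []; _∷_)
open import Data.Nat.Combinatorics using (nCk+nC[k+1]≡[n+1]C[k+1]) renaming (_C_ to _choose_)
open import Data.Nat.DivMod using (_/_; m*n/n≡m)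
open import Data.Nat.ListAction using (sum)
open import Data.Nat.ListAction.Properties using (sum-++; sum-↭)
open import Data.Nat.Properties
open import Data.Nat.Tactic.RingSolver using (solve-∀)
import Data.Rational.Properties as ℚ
open import Data.Rational.Unnormalised as ℚᵘ using (mkℚᵘ)
import Data.Rational.Unnormalised.Properties as ℚᵘ
open import Data.Sum using (_⊎_; inj₁; inj₂)
open import Function using (id; _∘_; case_of_)
open import Relation.Binary.PropositionalEquality
open import Relation.Nullary using (Dec; ¬_; yes; no; does; contradiction)
open import Relation.Nullary.Decidable using (map′)

-- The hard-core model

-- The conditioning leaves an arbitrary set of h available neighbours, so one estimate has to cover
-- every h. The two terms of the score cover the two ends: the mean of 2 |I ∩ N[v]| grows like 2 h /
-- m, while the probability of v is at worst about 1 / (m (1 + 1/m) ^ h). They meet near h = m s /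
-- 2. There the term for v is still worth about D / (m 2 ^ s), which has to be at least s. A small m
-- is therefore good, but adjacent pairs take up to P / m² from the mean of |I|, and this stays
-- bounded only from m = √P on. Hence 2 ^ s may grow nearly to D / √P, the origin of the logarithm
-- of D² / e. The 6 in e is that of a triangle count: P ordered adjacent pairs around each word make
-- P / 2 triangles through it, and a triangle has three corners. Probabilities are multiplied by
-- partition functions and logarithms are kept as exponents, so that the estimates compare natural
-- numbers.

𝟙 : Bool → ℕ
𝟙 b = if b then 1 else 0

+-interchange : ∀ a b c d → a + b + (c + d) ≡ (a + c) + (b + d)
+-interchange = solve-∀

+-rotate : ∀ a b c → a + b + c ≡ a + c + b
+-rotate = solve-∀

∑ : ∀ {A : Set} → List A → (A → ℕ) → ℕ
∑ L f = sum (map f L)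

module HardCore {A : Set} (a : A → A → Bool) (a-sym : ∀ x y → a x y ≡ a y x) (m : ℕ) where

  infixl 6 _∖_
  _∖_ : (A → Bool) → A → A → Bool
  (c ∖ x) y = c y ∧ not (a x y)

  _⊑_ : (A → Bool) → (A → Bool) → Set
  c ⊑ c′ = ∀ x → c x ≡ true → c′ x ≡ true

  ∖-⊑ : ∀ c x → (c ∖ x) ⊑ c
  ∖-⊑ c x y p with c y
  ... | true = refl

  ∖-mono : ∀ {c c′} x → c ⊑ c′ → (c ∖ x) ⊑ (c′ ∖ x)
  ∖-mono {c} {c′} x i y p with c y in eq
  ... | true rewrite i y eq = p

  ∖-comm : ∀ c x y → ((c ∖ x) ∖ y) ⊑ ((c ∖ y) ∖ x)
  ∖-comm c x y z p with c z | a x z | a y z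
  ... | true | false | false = refl

  -- The sum of m ^ (|L| − |I|) · (α + ∑ I f) over the conflict-free sublists I of L whose
  -- elements satisfy c, that is m ^ |L| times the hard-core sum of α + ∑ I f at fugacity 1 / m.
  W : (A → ℕ) → ℕ → (A → Bool) → List A → ℕ
  W f α c []      = α
  W f α c (x ∷ L) = m * W f α c L + (if c x then W f (α + f x) (c ∖ x) L else 0)

  Z : (A → Bool) → List A → ℕ
  Z = W (λ _ → 0) 1

  -- The unnormalised mean size of a conflict-free sublist.
  Y : (A → Bool) → List A → ℕ
  Y = W (λ _ → 1) 0

  W-mono : ∀ {f f′ α α′ c c′} L → All (λ x → f x ≤ f′ x) L → α ≤ α′ → c ⊑ c′ →
    W f α c L ≤ W f′ α′ c′ L
  W-mono [] _ p _ = p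
  W-mono {c = c} {c′} (x ∷ L) (q ∷ qs) p i with c x in eq | c′ x in eq′
  ... | true  | true  = +-mono-≤ (*-monoʳ-≤ m (W-mono L qs p i)) (W-mono L qs (+-mono-≤ p q) (∖-mono x i))
  ... | true  | false = contradiction (trans (sym (i x eq)) eq′) λ ()
  ... | false | _     = +-mono-≤ (*-monoʳ-≤ m (W-mono L qs p i)) z≤n

  W-⊑ : ∀ f α {c c′} L → c ⊑ c′ → W f α c L ≤ W f α c′ L
  W-⊑ f α L i = W-mono L (All.universal (λ _ → ≤-refl) L) ≤-refl i

  W-+ : ∀ f f′ α α′ c L → W (λ x → f x + f′ x) (α + α′) c L ≡ W f α c L + W f′ α′ c L
  W-+ f f′ α α′ c [] = refl
  W-+ f f′ α α′ c (x ∷ L) with c x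
  ... | false rewrite W-+ f f′ α α′ c L = lem m (W f α c L) (W f′ α′ c L)
    where lem : ∀ m u v → m * (u + v) + 0 ≡ (m * u + 0) + (m * v + 0)
          lem = solve-∀
  ... | true rewrite +-interchange α α′ (f x) (f′ x) | W-+ f f′ α α′ c L | W-+ f f′ (α + f x) (α′ + f′ x) (c ∖ x) L =
    lem m (W f α c L) (W f′ α′ c L) _ _
    where lem : ∀ m u v s t → m * (u + v) + (s + t) ≡ (m * u + s) + (m * v + t)
          lem = solve-∀

  W-0 : ∀ c L → W (λ _ → 0) 0 c L ≡ 0
  W-0 c [] = refl
  W-0 c (x ∷ L) with c x
  ... | false rewrite W-0 c L | *-zeroʳ m = refl
  ... | true rewrite W-0 c L | *-zeroʳ m | W-0 (c ∖ x) L = refl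

  W-* : ∀ k f α c L → W (λ x → k * f x) (k * α) c L ≡ k * W f α c L
  W-* zero    f α c L = W-0 c L
  W-* (suc k) f α c L = trans (W-+ f (λ x → k * f x) α (k * α) c L) (cong (W f α c L +_) (W-* k f α c L))

  W-suc : ∀ f α c L → W f (suc α) c L ≡ Z c L + W f α c L
  W-suc f α c L = W-+ (λ _ → 0) f 1 α c L

  W-shift : ∀ f α c L → W f α c L ≡ α * Z c L + W f 0 c L
  W-shift f zero    c L = refl
  W-shift f (suc α) c L = trans (W-suc f α c L)
    (trans (cong (Z c L +_) (W-shift f α c L)) (sym (+-assoc (Z c L) _ _)))

  W-∑ : ∀ {B : Set} (U : List B) (f : B → A → ℕ) c L →
    ∑ U (λ v → W (f v) 0 c L) ≡ W (λ x → ∑ U (λ v → f v x)) 0 c L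
  W-∑ []      f c L = sym (W-0 c L)
  W-∑ (v ∷ U) f c L = trans (cong (W (f v) 0 c L +_) (W-∑ U f c L))
    (sym (W-+ (f v) (λ x → ∑ U (λ w → f w x)) 0 0 c L))

  W-swap : ∀ f α c x y L → W f α c (x ∷ y ∷ L) ≡ W f α c (y ∷ x ∷ L)
  W-swap f α c x y L with c x in ex | c y in ey | a x y in exy | a y x in eyx
  ... | false | false | _ | _ = refl
  ... | false | true  | _ | _ = lem m _ _
    where lem : ∀ m u v → m * (m * u + v) + 0 ≡ m * (m * u + 0) + (m * v + 0)
          lem = solve-∀
  ... | true  | false | _ | _ = lem m _ _
    where lem : ∀ m u v → m * (m * u + 0) + (m * v + 0) ≡ m * (m * u + v) + 0
          lem = solve-∀
  ... | true  | true  | true  | true  = lem m _ _ _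
    where lem : ∀ m u v w → m * (m * u + v) + (m * w + 0) ≡ m * (m * u + w) + (m * v + 0)
          lem = solve-∀
  -- The predicates left after removing `x` and `y` in the two orders agree pointwise but not by
  -- computation; monotonicity in both directions gives equal sums.
  ... | true  | true  | false | false rewrite
        +-rotate α (f x) (f y)
      | ≤-antisym (W-⊑ f (α + f y + f x) L (∖-comm c x y)) (W-⊑ f (α + f y + f x) L (∖-comm c y x))
      = lem m _ _ _ _
    where lem : ∀ m u v w z → m * (m * u + v) + (m * w + z) ≡ m * (m * u + w) + (m * v + z)
          lem = solve-∀
  ... | true  | true  | true  | false = contradiction (trans (sym exy) (trans (a-sym x y) eyx)) λ ()
  ... | true  | true  | false | true  = contradiction (trans (sym exy) (trans (a-sym x y) eyx)) λ ()

  W-prep : ∀ f x L L′ → (∀ α c → W f α c L ≡ W f α c L′) → ∀ α c → W f α c (x ∷ L) ≡ W f α c (x ∷ L′)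
  W-prep f x L L′ e α c rewrite e α c | e (α + f x) (c ∖ x) = refl

  -- The recursion fixes one order of the words, but each `v` needs its own: first the words far
  -- from `v`, then `v`, then its neighbours. This allows the change of order.
  W-↭ : ∀ f {L L′} → L ↭ L′ → ∀ α c → W f α c L ≡ W f α c L′
  W-↭ f ↭.refl α c = refl
  W-↭ f (↭.prep {L} {L′} x p) α c = W-prep f x L L′ (W-↭ f p) α c
  W-↭ f (↭.swap {L} {L′} x y p) α c =
    trans (W-swap f α c x y L) (W-prep f y (x ∷ L) (x ∷ L′) (W-prep f x L L′ (W-↭ f p)) α c)
  W-↭ f (↭.trans p q) α c = trans (W-↭ f p α c) (W-↭ f q α c)

  Independent : (A → Bool) → List A → Set
  Independent c I = AllPairs (λ x y → a x y ≡ false) I × All (λ x → c x ≡ true) I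

  -- The first-moment method: either some I reaches t, or α + ∑ I f has mean at most t − 1.
  find : ∀ t f α c L → (∃[ I ] (Independent c I × t ≤ α + ∑ I f)) ⊎ W f (suc α) c L ≤ t * Z c L
  find t f α c [] with t ≤? α
  ... | yes p = inj₁ ([] , ([] , []) , subst (t ≤_) (sym (+-identityʳ α)) p)
  ... | no  p = inj₂ (subst (suc α ≤_) (sym (*-identityʳ t)) (≰⇒> p))
  find t f α c (x ∷ L) with find t f α c L
  ... | inj₁ r = inj₁ r
  ... | inj₂ r with c x in ex
  ...   | false = inj₂ (≤-trans (+-monoˡ-≤ 0 (*-monoʳ-≤ m r)) (≤-reflexive (lem m t _)))
    where lem : ∀ m t z → m * (t * z) + 0 ≡ t * (m * z + 0)
          lem = solve-∀
  ...   | true with find t f (α + f x) (c ∖ x) L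
  ...     | inj₁ (I , (p , q) , r′) = inj₁ (x ∷ I , (All.map sep q ∷ p , ex ∷ All.map (∖-⊑ c x _) q) ,
              subst (t ≤_) (+-assoc α (f x) _) r′)
    where sep : ∀ {y} → (c ∖ x) y ≡ true → a x y ≡ false
          sep {y} e with c y | a x y
          ... | true | false = refl
  ...     | inj₂ r′ = inj₂ (≤-trans (+-mono-≤ (*-monoʳ-≤ m r) r′) (≤-reflexive (lem m t _ _)))
    where lem : ∀ m t z w → m * (t * z) + t * w ≡ t * (m * z + w)
          lem = solve-∀

  activeDegree : A → (A → Bool) → List A → ℕ
  activeDegree x c L = ∑ L (λ y → 𝟙 (c y ∧ a x y))

  active : (A → Bool) → List A → ℕ
  active c L = ∑ L (λ x → 𝟙 (c x))

  activePairs : (A → Bool) → List A → ℕ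
  activePairs c []      = 0
  activePairs c (x ∷ L) = (if c x then 2 * activeDegree x c L else 0) + activePairs c L

  active-∖ : ∀ c x L → active (c ∖ x) L + activeDegree x c L ≡ active c L
  active-∖ c x [] = refl
  active-∖ c x (y ∷ L) with active-∖ c x L | c y | a x y
  ... | ih | false | _     = ih
  ... | ih | true  | true  = trans (+-suc _ _) (cong suc ih)
  ... | ih | true  | false = cong suc ih

  activeDegree-mono : ∀ x {c c′} L → c ⊑ c′ → activeDegree x c L ≤ activeDegree x c′ L
  activeDegree-mono x [] i = z≤n
  activeDegree-mono x {c} {c′} (y ∷ L) i with c y in eq
  ... | false = ≤-trans (activeDegree-mono x L i) (m≤n+m _ _)
  ... | true rewrite i y eq = +-monoʳ-≤ (𝟙 (a x y)) (activeDegree-mono x L i)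

  activePairs-mono : ∀ {c c′} L → c ⊑ c′ → activePairs c L ≤ activePairs c′ L
  activePairs-mono [] i = z≤n
  activePairs-mono {c} {c′} (x ∷ L) i with c x in eq
  ... | false = ≤-trans (activePairs-mono L i) (m≤n+m _ _)
  ... | true rewrite i x eq = +-mono-≤ (*-monoʳ-≤ 2 (activeDegree-mono x L i)) (activePairs-mono L i)

  -- A union bound over the neighbours of x.
  Z-∖-lower : ∀ x c L → m * Z c L ≤ m * Z (c ∖ x) L + activeDegree x c L * Z c L
  Z-∖-lower x c [] = m≤m+n _ _
  Z-∖-lower x c (y ∷ L) with c y in ey
  ... | false = ≤-trans (*-monoʳ-≤ m (+-monoˡ-≤ 0 (Z-∖-lower x c L))) (≤-reflexive (lem m _ (activeDegree x c L) (Z c L)))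
    where lem : ∀ m z d u → m * (m * z + d * u + 0) ≡ m * (m * z + 0) + d * (m * u + 0)
          lem = solve-∀
  ... | true with a x y
  ...   | true  = begin
    m * (m * Z c L + Z (c ∖ y) L)
      ≡⟨ lem₁ m (Z c L) (Z (c ∖ y) L) ⟩
    m * (m * Z c L) + m * Z (c ∖ y) L
      ≤⟨ +-mono-≤ (*-monoʳ-≤ m (Z-∖-lower x c L)) (*-monoʳ-≤ m (W-⊑ _ 1 L (∖-⊑ c y))) ⟩
    m * (m * Z (c ∖ x) L + activeDegree x c L * Z c L) + m * Z c L
      ≤⟨ m≤m+n _ (Z (c ∖ y) L + activeDegree x c L * Z (c ∖ y) L) ⟩
    m * (m * Z (c ∖ x) L + activeDegree x c L * Z c L) + m * Z c L + (Z (c ∖ y) L + activeDegree x c L * Z (c ∖ y) L)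
      ≡⟨ lem₂ m (Z (c ∖ x) L) (activeDegree x c L) (Z c L) (Z (c ∖ y) L) ⟩
    m * (m * Z (c ∖ x) L + 0) + suc (activeDegree x c L) * (m * Z c L + Z (c ∖ y) L) ∎
    where open ≤-Reasoning
          lem₁ : ∀ m z w → m * (m * z + w) ≡ m * (m * z) + m * w
          lem₁ = solve-∀
          lem₂ : ∀ m z d u w → m * (m * z + d * u) + m * u + (w + d * w) ≡ m * (m * z + 0) + (1 + d) * (m * u + w)
          lem₂ = solve-∀
  ...   | false = begin
    m * (m * Z c L + Z (c ∖ y) L)
      ≡⟨ lem₁ m (Z c L) (Z (c ∖ y) L) ⟩
    m * (m * Z c L) + m * Z (c ∖ y) L
      ≤⟨ +-mono-≤ (*-monoʳ-≤ m (Z-∖-lower x c L)) (Z-∖-lower x (c ∖ y) L) ⟩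
    m * (m * Z (c ∖ x) L + activeDegree x c L * Z c L) + (m * Z ((c ∖ y) ∖ x) L + activeDegree x (c ∖ y) L * Z (c ∖ y) L)
      ≤⟨ +-monoʳ-≤ (m * (m * Z (c ∖ x) L + activeDegree x c L * Z c L))
           (+-mono-≤ (*-monoʳ-≤ m (W-⊑ _ 1 L (∖-comm c y x))) (*-monoˡ-≤ (Z (c ∖ y) L) (activeDegree-mono x L (∖-⊑ c y)))) ⟩
    m * (m * Z (c ∖ x) L + activeDegree x c L * Z c L) + (m * Z ((c ∖ x) ∖ y) L + activeDegree x c L * Z (c ∖ y) L)
      ≡⟨ lem₂ m (Z (c ∖ x) L) (activeDegree x c L) (Z c L) (Z (c ∖ y) L) (Z ((c ∖ x) ∖ y) L) ⟩
    m * (m * Z (c ∖ x) L + Z ((c ∖ x) ∖ y) L) + activeDegree x c L * (m * Z c L + Z (c ∖ y) L) ∎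
    where open ≤-Reasoning
          lem₁ : ∀ m z w → m * (m * z + w) ≡ m * (m * z) + m * w
          lem₁ = solve-∀
          lem₂ : ∀ m z d u w v → m * (m * z + d * u) + (m * v + d * w) ≡ m * (m * z + v) + d * (m * u + w)
          lem₂ = solve-∀

  -- For positive m and with h active elements and p ordered adjacent pairs, this says that |I| has
  -- mean at least h / (m + 1) - p / (m (m + 1)). In the induction the degree of `x` is paid twice,
  -- hence the factor 2 in `activePairs`: once through the union bound, since a sublist without `x`
  -- cannot always be extended by `x`, and once because the neighbours of `x` cease to be active
  -- when `x` is chosen.
  Y-lower : ∀ c L → m * active c L * Z c L ≤ m * suc m * Y c L + activePairs c L * Z c L
  Y-lower c [] = ≤-reflexive (lem m)
    where lem : ∀ m → m * 0 * 1 ≡ m * (1 + m) * 0 + 0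
          lem = solve-∀
  Y-lower c (x ∷ L) with c x
  ... | false = ≤-trans (≤-reflexive (lem₁ m (active c L) (Z c L)))
      (≤-trans (*-monoʳ-≤ m (Y-lower c L)) (≤-reflexive (lem₂ m (Y c L) (activePairs c L) (Z c L))))
    where lem₁ : ∀ m h z → m * h * (m * z + 0) ≡ m * (m * h * z)
          lem₁ = solve-∀
          lem₂ : ∀ m y p z → m * (m * (1 + m) * y + p * z) ≡ m * (1 + m) * (m * y + 0) + p * (m * z + 0)
          lem₂ = solve-∀
  ... | true rewrite W-suc (λ _ → 1) 0 (c ∖ x) L | sym (active-∖ c x L) =
    arithmetic (Z c L) (Z (c ∖ x) L) (Y c L) (Y (c ∖ x) L) (active (c ∖ x) L) (activeDegree x c L) (activePairs c L)
      (subst (λ h → m * h * Z c L ≤ m * suc m * Y c L + activePairs c L * Z c L) (sym (active-∖ c x L)) (Y-lower c L))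
      (≤-trans (Y-lower (c ∖ x) L) (+-monoʳ-≤ _ (*-monoˡ-≤ (Z (c ∖ x) L) (activePairs-mono L (∖-⊑ c x)))))
      (Z-∖-lower x c L)
      (W-⊑ _ 1 L (∖-⊑ c x))
    where
    arithmetic : ∀ z₁ z₂ y₁ y₂ h d p →
      m * (h + d) * z₁ ≤ m * suc m * y₁ + p * z₁ →
      m * h * z₂ ≤ m * suc m * y₂ + p * z₂ →
      m * z₁ ≤ m * z₂ + d * z₁ →
      z₂ ≤ z₁ →
      m * suc (h + d) * (m * z₁ + z₂) ≤ m * suc m * (m * y₁ + (z₂ + y₂)) + (2 * d + p) * (m * z₁ + z₂)
    arithmetic z₁ z₂ y₁ y₂ h d p e₁ e₂ e₃ e₄ = begin
      m * suc (h + d) * (m * z₁ + z₂)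
        ≡⟨ lem₁ m h d z₁ z₂ ⟩
      m * (m * (h + d) * z₁) + m * h * z₂ + m * (m * z₁) + m * d * z₂ + m * z₂
        ≤⟨ +-monoˡ-≤ (m * z₂) (+-mono-≤ (+-mono-≤ (+-mono-≤ (*-monoʳ-≤ m e₁) e₂) (*-monoʳ-≤ m e₃)) (*-monoʳ-≤ (m * d) e₄)) ⟩
      m * (m * suc m * y₁ + p * z₁) + (m * suc m * y₂ + p * z₂) + m * (m * z₂ + d * z₁) + m * d * z₁ + m * z₂
        ≤⟨ m≤m+n _ (2 * d * z₂) ⟩
      m * (m * suc m * y₁ + p * z₁) + (m * suc m * y₂ + p * z₂) + m * (m * z₂ + d * z₁) + m * d * z₁ + m * z₂ + 2 * d * z₂
        ≡⟨ lem₂ m d p z₁ z₂ y₁ y₂ ⟩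
      m * suc m * (m * y₁ + (z₂ + y₂)) + (2 * d + p) * (m * z₁ + z₂) ∎
      where
      open ≤-Reasoning
      lem₁ : ∀ m h d z₁ z₂ → m * (1 + (h + d)) * (m * z₁ + z₂) ≡
        m * (m * (h + d) * z₁) + m * h * z₂ + m * (m * z₁) + m * d * z₂ + m * z₂
      lem₁ = solve-∀
      lem₂ : ∀ m d p z₁ z₂ y₁ y₂ →
        m * (m * (1 + m) * y₁ + p * z₁) + (m * (1 + m) * y₂ + p * z₂) + m * (m * z₂ + d * z₁) + m * d * z₁ + m * z₂ + 2 * d * z₂
        ≡ m * (1 + m) * (m * y₁ + (z₂ + y₂)) + (2 * d + p) * (m * z₁ + z₂)
      lem₂ = solve-∀

  -- If conflicts are ignored, every active element multiplies the sum by 1 + 1/m relative to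
  -- `m ^ length L`; conflicts only remove terms.
  Z-upper : ∀ c L → Z c L * m ^ active c L ≤ m ^ length L * suc m ^ active c L
  Z-upper c [] = ≤-refl
  Z-upper c (x ∷ L) with c x
  ... | false = ≤-trans (≤-reflexive (lem m (Z c L) _)) (≤-trans (*-monoʳ-≤ m (Z-upper c L)) (≤-reflexive (sym (*-assoc m _ _))))
    where lem : ∀ m z u → (m * z + 0) * u ≡ m * (z * u)
          lem = solve-∀
  ... | true = begin
    (m * Z c L + Z (c ∖ x) L) * (m * m ^ active c L)
      ≤⟨ *-monoˡ-≤ (m * m ^ active c L) (+-monoʳ-≤ (m * Z c L) (W-⊑ _ 1 L (∖-⊑ c x))) ⟩
    (m * Z c L + Z c L) * (m * m ^ active c L)
      ≡⟨ lem₁ m (Z c L) (m ^ active c L) ⟩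
    m * suc m * (Z c L * m ^ active c L)
      ≤⟨ *-monoʳ-≤ (m * suc m) (Z-upper c L) ⟩
    m * suc m * (m ^ length L * suc m ^ active c L)
      ≡⟨ lem₂ m (m ^ length L) (suc m ^ active c L) ⟩
    m * m ^ length L * (suc m * suc m ^ active c L) ∎
    where open ≤-Reasoning
          lem₁ : ∀ m z u → (m * z + z) * (m * u) ≡ m * (1 + m) * (z * u)
          lem₁ = solve-∀
          lem₂ : ∀ m z u → m * (1 + m) * (z * u) ≡ m * z * ((1 + m) * u)
          lem₂ = solve-∀

  -- The double sum also meets each element paired with itself. These `length L` diagonal terms
  -- become, for the neighbours of a word, the subtracted D - 1 in P.
  activePairs≤∑ : (∀ x → a x x ≡ true) → ∀ c L →
    activePairs c L + length L ≤ ∑ L (λ x → ∑ L (λ y → 𝟙 (a x y)))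
  activePairs≤∑ a-refl c [] = z≤n
  activePairs≤∑ a-refl c (x ∷ L) rewrite a-refl x = begin
    (if c x then 2 * activeDegree x c L else 0) + activePairs c L + suc (length L)
      ≤⟨ +-monoˡ-≤ _ (+-monoˡ-≤ _ (if-≤ (c x))) ⟩
    2 * activeDegree x c L + activePairs c L + suc (length L)
      ≤⟨ +-monoˡ-≤ _ (+-monoˡ-≤ _ (*-monoʳ-≤ 2 deg≤)) ⟩
    2 * ∑ L (λ y → 𝟙 (a x y)) + activePairs c L + suc (length L)
      ≡⟨ lem (∑ L (λ y → 𝟙 (a x y))) (activePairs c L) (length L) ⟩
    suc (∑ L (λ y → 𝟙 (a x y)) + (∑ L (λ y → 𝟙 (a x y)) + (activePairs c L + length L)))
      ≤⟨ s≤s (+-monoʳ-≤ (∑ L (λ y → 𝟙 (a x y))) (+-monoʳ-≤ _ (activePairs≤∑ a-refl c L))) ⟩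
    suc (∑ L (λ y → 𝟙 (a x y)) + (∑ L (λ y → 𝟙 (a x y)) + ∑ L (λ x → ∑ L (λ y → 𝟙 (a x y)))))
      ≡⟨ cong (λ k → suc (∑ L (λ y → 𝟙 (a x y)) + k)) (column L L) ⟩
    suc (∑ L (λ y → 𝟙 (a x y)) + ∑ L (λ z → 𝟙 (a z x) + ∑ L (λ y → 𝟙 (a z y)))) ∎
    where
    open ≤-Reasoning
    if-≤ : ∀ b {k} → (if b then k else 0) ≤ k
    if-≤ true  = ≤-refl
    if-≤ false = z≤n
    deg≤ : activeDegree x c L ≤ ∑ L (λ y → 𝟙 (a x y))
    deg≤ = activeDegree-mono x L λ _ _ → refl
    lem : ∀ d p l → 2 * d + p + (1 + l) ≡ 1 + (d + (d + (p + l)))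
    lem = solve-∀
    column : ∀ K M → ∑ K (λ y → 𝟙 (a x y)) + ∑ K (λ z → ∑ M (λ y → 𝟙 (a z y))) ≡
      ∑ K (λ z → 𝟙 (a z x) + ∑ M (λ y → 𝟙 (a z y)))
    column [] M = refl
    column (z ∷ K) M = trans (+-interchange (𝟙 (a x z)) _ _ _)
      (cong₂ _+_ (cong (λ b → 𝟙 b + ∑ M (λ y → 𝟙 (a z y))) (a-sym x z)) (column K M))

  -- Once `v` is chosen no element of `L` is allowed, so only the empty sublist contributes.
  W-blocked : ∀ f α c v L → All (λ x → a v x ≡ true) L → W f α (c ∖ v) L ≡ α * m ^ length L
  W-blocked f α c v [] [] = sym (*-identityʳ α)
  W-blocked f α c v (x ∷ L) (p ∷ ps) with c x ∧ not (a v x) in eq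
  ... | false = trans (cong (λ k → m * k + 0) (W-blocked f α c v L ps)) (lem m α _)
    where lem : ∀ m α u → m * (α * u) + 0 ≡ α * (m * u)
          lem = solve-∀
  ... | true rewrite p with c x
  ...   | true = contradiction eq λ ()
  W-blocked f α c v (x ∷ L) (p ∷ ps) | true | false = contradiction eq λ ()

-- Inequalities between powers

^-distribʳ-* : ∀ a b n → (a * b) ^ n ≡ a ^ n * b ^ n
^-distribʳ-* a b zero    = refl
^-distribʳ-* a b (suc n) rewrite ^-distribʳ-* a b n = lem a b (a ^ n) (b ^ n)
  where lem : ∀ a b c d → a * b * (c * d) ≡ a * c * (b * d)
        lem = solve-∀

^-comm-exponents : ∀ a m n → (a ^ m) ^ n ≡ (a ^ n) ^ m
^-comm-exponents a m n = trans (^-*-assoc a m n) (trans (cong (a ^_) (*-comm m n)) (sym (^-*-assoc a n m)))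

^-cancelˡ-≤ : ∀ n .{{_ : NonZero n}} {a b} → a ^ n ≤ b ^ n → a ≤ b
^-cancelˡ-≤ n {a} {b} p with a ≤? b
... | yes q = q
... | no  q = contradiction p (<⇒≱ (^-monoˡ-< n (≰⇒> q)))

-- Bernoulli's inequality 1 + k/x ≤ (1 + 1/x) ^ k, multiplied by x ^ (k + 1) to avoid fractions.
bernoulli : ∀ x k → x ^ k * (x + k) ≤ x * suc x ^ k
bernoulli x zero    = ≤-reflexive (lem x)
  where lem : ∀ x → 1 * (x + 0) ≡ x * 1
        lem = solve-∀
bernoulli x (suc k) = begin
  x * x ^ k * (x + suc k)                  ≤⟨ m≤m+n _ (k * x ^ k) ⟩
  x * x ^ k * (x + suc k) + k * x ^ k      ≡⟨ lem₁ x (x ^ k) k ⟩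
  suc x * (x ^ k * (x + k))                ≤⟨ *-monoʳ-≤ (suc x) (bernoulli x k) ⟩
  suc x * (x * suc x ^ k)                  ≡⟨ lem₂ x (suc x ^ k) ⟩
  x * (suc x * suc x ^ k)                  ∎
  where
  open ≤-Reasoning
  lem₁ : ∀ x u k → x * u * (x + (1 + k)) + k * u ≡ (1 + x) * (u * (x + k))
  lem₁ = solve-∀
  lem₂ : ∀ x u → (1 + x) * (x * u) ≡ x * ((1 + x) * u)
  lem₂ = solve-∀

-- (1 + 1/m) ^ (m + 1) is decreasing in m.
[1+m]^[1+m]≤4*m^[1+m] : ∀ m .{{_ : NonZero m}} → suc m ^ suc m ≤ 4 * m ^ suc m
[1+m]^[1+m]≤4*m^[1+m] (suc zero)        = ≤-refl
[1+m]^[1+m]≤4*m^[1+m] (suc k@(suc _)) = *-cancelˡ-≤ (k ^ suc k) {{m^n≢0 k (suc k)}} (begin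
  k ^ suc k * suc m ^ suc m
    ≤⟨ *-cancelˡ-≤ (k * suc m) {{m*n≢0 k (suc m)}} scaled ⟩
  suc k ^ suc k * m ^ suc m
    ≤⟨ *-monoˡ-≤ (m ^ suc m) ([1+m]^[1+m]≤4*m^[1+m] k) ⟩
  4 * k ^ suc k * m ^ suc m
    ≡⟨ lem₅ (k ^ suc k) (m ^ suc m) ⟩
  k ^ suc k * (4 * m ^ suc m) ∎)
  where
  open ≤-Reasoning
  m = suc k
  -- This is m² - 1. The ratio of consecutive terms is (1 + 1/x) ^ m divided by 1 + 1/m, and
  -- Bernoulli gives (1 + 1/x) ^ m ≥ 1 + m/x ≥ 1 + 1/m.
  x = k * suc m
  lem₁ : ∀ x y w t → x * y * (t * (w * t)) ≡ x * t * (y * (w * t))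
  lem₁ = solve-∀
  lem₅ : ∀ a b → 4 * a * b ≡ a * (4 * b)
  lem₅ = solve-∀
  sq : suc x ≡ m * m
  sq = lem k
    where lem : ∀ k → 1 + k * (2 + k) ≡ (1 + k) * (1 + k)
          lem = solve-∀
  lem₂ : ∀ k u v → k * (2 + k) * (u * ((2 + k) * v)) ≡ (u * v) * (k * (2 + k) * (2 + k))
  lem₂ = solve-∀
  lem₃ : ∀ k → k * (2 + k) * (2 + k) + 1 ≡ (1 + k) * (k * (2 + k) + (1 + k))
  lem₃ = solve-∀
  lem₄ : ∀ m w x → m * (x * (w * w)) ≡ x * (w * (m * w))
  lem₄ = solve-∀
  scaled : x * (k ^ suc k * suc m ^ suc m) ≤ x * (suc k ^ suc k * m ^ suc m)
  scaled = begin
    x * (k ^ m * (suc m * suc m ^ m))         ≡⟨ lem₂ k (k ^ m) (suc m ^ m) ⟩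
    (k ^ m * suc m ^ m) * (x * suc m)         ≡⟨ cong (_* (x * suc m)) (^-distribʳ-* k (suc m) m) ⟨
    x ^ m * (x * suc m)                       ≤⟨ *-monoʳ-≤ (x ^ m) (≤-trans (m≤m+n _ 1) (≤-reflexive (lem₃ k))) ⟩
    x ^ m * (m * (x + m))                     ≡⟨ swap (x ^ m) m (x + m) ⟩
    m * (x ^ m * (x + m))                     ≤⟨ *-monoʳ-≤ m (bernoulli x m) ⟩
    m * (x * suc x ^ m)                       ≡⟨ cong (λ u → m * (x * u ^ m)) sq ⟩
    m * (x * (m * m) ^ m)                     ≡⟨ cong (λ u → m * (x * u)) (^-distribʳ-* m m m) ⟩
    m * (x * (m ^ m * m ^ m))                 ≡⟨ lem₄ m (m ^ m) x ⟩
    x * (m ^ m * (m * m ^ m))                 ∎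
    where swap : ∀ u m w → u * (m * w) ≡ m * (u * w)
          swap = solve-∀

-- Mean scores around one element

module _ {A : Set} (a : A → A → Bool) (a-sym : ∀ x y → a x y ≡ a y x) (m : ℕ) .{{_ : NonZero m}} where

  open HardCore a a-sym m

  -- By `Z-upper` and (1 + 1/m) ^ (m + 1) ≤ 4, the ratio of Z to `m ^ length L` is at most 4 ^ (h /
  -- (m + 1)). Both sides are raised to the power m + 1 to keep exponents integral.
  Z≤2^k : ∀ k c L → 2 * active c L ≤ k * suc m → Z c L ≤ m ^ length L * 2 ^ k
  Z≤2^k k c L p = ^-cancelˡ-≤ (suc m) (*-cancelʳ-≤ _ _ ((m ^ suc m) ^ h) {{m^n≢0 (m ^ suc m) h {{m^n≢0 m (suc m)}}}} (begin
    z ^ suc m * (m ^ suc m) ^ h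
      ≡⟨ cong (z ^ suc m *_) (^-comm-exponents m (suc m) h) ⟩
    z ^ suc m * (m ^ h) ^ suc m
      ≡⟨ ^-distribʳ-* z (m ^ h) (suc m) ⟨
    (z * m ^ h) ^ suc m
      ≤⟨ ^-monoˡ-≤ (suc m) (Z-upper c L) ⟩
    (M * suc m ^ h) ^ suc m
      ≡⟨ ^-distribʳ-* M (suc m ^ h) (suc m) ⟩
    M ^ suc m * (suc m ^ h) ^ suc m
      ≡⟨ cong (M ^ suc m *_) (^-comm-exponents (suc m) h (suc m)) ⟩
    M ^ suc m * (suc m ^ suc m) ^ h
      ≤⟨ *-monoʳ-≤ (M ^ suc m) (^-monoˡ-≤ h ([1+m]^[1+m]≤4*m^[1+m] m)) ⟩
    M ^ suc m * (4 * m ^ suc m) ^ h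
      ≡⟨ cong (M ^ suc m *_) (^-distribʳ-* 4 (m ^ suc m) h) ⟩
    M ^ suc m * (4 ^ h * (m ^ suc m) ^ h)
      ≡⟨ *-assoc (M ^ suc m) _ _ ⟨
    M ^ suc m * 4 ^ h * (m ^ suc m) ^ h
      ≤⟨ *-monoˡ-≤ ((m ^ suc m) ^ h) (*-monoʳ-≤ (M ^ suc m) 4^h≤) ⟩
    M ^ suc m * (2 ^ k) ^ suc m * (m ^ suc m) ^ h
      ≡⟨ cong (_* (m ^ suc m) ^ h) (^-distribʳ-* M (2 ^ k) (suc m)) ⟨
    (M * 2 ^ k) ^ suc m * (m ^ suc m) ^ h ∎))
    where
    open ≤-Reasoning
    z = Z c L
    h = active c L
    M = m ^ length L
    4^h≤ : 4 ^ h ≤ (2 ^ k) ^ suc m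
    4^h≤ = begin
      4 ^ h            ≡⟨ ^-*-assoc 2 2 h ⟩
      2 ^ (2 * h)      ≤⟨ ^-monoʳ-≤ 2 p ⟩
      2 ^ (k * suc m)  ≡⟨ ^-*-assoc 2 k (suc m) ⟨
      (2 ^ k) ^ suc m  ∎

  -- Here P ≤ m² enters: adjacent pairs cost no more than m of the h active elements contribute.
  [h∸m]Z≤[1+m]Y : ∀ c L → activePairs (λ _ → true) L ≤ m * m → active c L * Z c L ≤ suc m * Y c L + m * Z c L
  [h∸m]Z≤[1+m]Y c L p = *-cancelˡ-≤ m (begin
    m * (active c L * Z c L)                       ≡⟨ *-assoc m _ _ ⟨
    m * active c L * Z c L                         ≤⟨ Y-lower c L ⟩
    m * suc m * Y c L + activePairs c L * Z c L
      ≤⟨ +-monoʳ-≤ _ (*-monoˡ-≤ (Z c L) (≤-trans (activePairs-mono {c} L (λ _ _ → refl)) p)) ⟩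
    m * suc m * Y c L + m * m * Z c L              ≡⟨ lem m (Y c L) (Z c L) ⟩
    m * (suc m * Y c L + m * Z c L)                ∎)
    where
    open ≤-Reasoning
    lem : ∀ m y z → m * (1 + m) * y + m * m * z ≡ m * ((1 + m) * y + m * z)
    lem = solve-∀

  -- If many neighbours of v are available then they contribute enough by themselves;
  -- otherwise Z is small and v itself is likely to be chosen.
  neighbourhood-mean : ∀ s D c L → s * (1 + m * 2 ^ (2 + s)) ≤ D → activePairs (λ _ → true) L ≤ m * m →
    s * (m * Z c L + m ^ length L) ≤ m * (2 * Y c L) + D * m ^ length L
  -- The cut is at h = (s + 2)(m + 1) / 2. Above it 2 |I| has mean at least 2 (h - m) / (m + 1) ≥ s.
  -- Below it Z is at most 2 ^ (s + 2) times `m ^ length L`; as `v` excludes all of `L`, it is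
  -- chosen with probability at least 1 / (1 + m 2 ^ (s + 2)).
  neighbourhood-mean s D c L s≤D p with (2 + s) * suc m ≤? 2 * active c L
  ... | yes many = begin
    s * (m * Z c L + M)                ≡⟨ lem₁ s m (Z c L) M ⟩
    m * (s * Z c L) + s * M            ≤⟨ +-mono-≤ (*-monoʳ-≤ m sZ≤2Y) (*-monoˡ-≤ M (≤-trans (m≤m*n s _) s≤D)) ⟩
    m * (2 * Y c L) + D * M            ∎
    where
    open ≤-Reasoning
    M = m ^ length L
    lem₁ : ∀ s m z u → s * (m * z + u) ≡ m * (s * z) + s * u
    lem₁ = solve-∀
    sZ≤2Y : s * Z c L ≤ 2 * Y c L
    sZ≤2Y = *-cancelˡ-≤ (suc m) (+-cancelʳ-≤ (2 * (m * Z c L)) _ _ (begin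
      suc m * (s * Z c L) + 2 * (m * Z c L)
        ≤⟨ m≤m+n _ (2 * Z c L) ⟩
      suc m * (s * Z c L) + 2 * (m * Z c L) + 2 * Z c L
        ≡⟨ lem₂ s m (Z c L) ⟩
      (2 + s) * suc m * Z c L
        ≤⟨ *-monoˡ-≤ (Z c L) many ⟩
      2 * active c L * Z c L
        ≡⟨ *-assoc 2 (active c L) (Z c L) ⟩
      2 * (active c L * Z c L)
        ≤⟨ *-monoʳ-≤ 2 ([h∸m]Z≤[1+m]Y c L p) ⟩
      2 * (suc m * Y c L + m * Z c L)
        ≡⟨ lem₃ m (Y c L) (Z c L) ⟩
      suc m * (2 * Y c L) + 2 * (m * Z c L) ∎))
      where
      lem₂ : ∀ s m z → (1 + m) * (s * z) + 2 * (m * z) + 2 * z ≡ (2 + s) * (1 + m) * z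
      lem₂ = solve-∀
      lem₃ : ∀ m y z → 2 * ((1 + m) * y + m * z) ≡ (1 + m) * (2 * y) + 2 * (m * z)
      lem₃ = solve-∀
  ... | no few = begin
    s * (m * Z c L + M)
      ≤⟨ *-monoʳ-≤ s (+-monoˡ-≤ M (*-monoʳ-≤ m (Z≤2^k (2 + s) c L (<⇒≤ (≰⇒> few))))) ⟩
    s * (m * (M * 2 ^ (2 + s)) + M)
      ≡⟨ lem s m M (2 ^ (2 + s)) ⟩
    s * (1 + m * 2 ^ (2 + s)) * M
      ≤⟨ *-monoˡ-≤ M s≤D ⟩
    D * M
      ≤⟨ m≤n+m _ _ ⟩
    m * (2 * Y c L) + D * M ∎
    where
    open ≤-Reasoning
    M = m ^ length L
    lem : ∀ s m u t → s * (m * (u * t) + u) ≡ s * (1 + m * t) * u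
    lem = solve-∀

  -- Unrolling `W` along `R` is the conditioning: each branch fixes the choices in `R` and leaves
  -- some predicate `c` on `L`. It still allows `v`, since nothing in `R` is adjacent to `v`, and
  -- `neighbourhood-mean` applies to every such `c`. What the chosen members of `R` add to the score
  -- is discarded.
  local-mean : ∀ s D f v R L → s * (1 + m * 2 ^ (2 + s)) ≤ D → activePairs (λ _ → true) L ≤ m * m →
    D ≤ f v → All (λ x → 2 ≤ f x) L → All (λ x → a v x ≡ true) L → All (λ x → a v x ≡ false) R →
    ∀ c → c v ≡ true → s * Z c (R ++ v ∷ L) ≤ W f 0 c (R ++ v ∷ L)
  local-mean s D f v [] L s≤D p D≤fv 2≤f av [] c cv rewrite cv
    | W-blocked (λ _ → 0) 1 c v L av | W-blocked f (f v) c v L av = begin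
    s * (m * Z c L + (M + 0))       ≡⟨ cong (λ k → s * (m * Z c L + k)) (+-identityʳ M) ⟩
    s * (m * Z c L + M)             ≤⟨ neighbourhood-mean s D c L s≤D p ⟩
    m * (2 * Y c L) + D * M         ≤⟨ +-mono-≤ (*-monoʳ-≤ m 2Y≤W) (*-monoˡ-≤ M D≤fv) ⟩
    m * W f 0 c L + f v * M         ∎
    where
    open ≤-Reasoning
    M = m ^ length L
    2Y≤W : 2 * Y c L ≤ W f 0 c L
    2Y≤W = ≤-trans (≤-reflexive (sym (W-* 2 (λ _ → 1) 0 c L))) (W-mono {c = c} L 2≤f ≤-refl (λ _ → id))
  local-mean s D f v (x ∷ R) L s≤D p D≤fv 2≤f av (ax ∷ aR) c cv with c x
  ... | false = begin
    s * (m * Z c K + 0)     ≡⟨ lem s m (Z c K) ⟩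
    m * (s * Z c K) + 0     ≤⟨ +-monoˡ-≤ 0 (*-monoʳ-≤ m (local-mean s D f v R L s≤D p D≤fv 2≤f av aR c cv)) ⟩
    m * W f 0 c K + 0       ∎
    where
    open ≤-Reasoning
    K = R ++ v ∷ L
    lem : ∀ s m z → s * (m * z + 0) ≡ m * (s * z) + 0
    lem = solve-∀
  ... | true = begin
    s * (m * Z c K + Z (c ∖ x) K)
      ≡⟨ lem s m (Z c K) (Z (c ∖ x) K) ⟩
    m * (s * Z c K) + s * Z (c ∖ x) K
      ≤⟨ +-mono-≤ (*-monoʳ-≤ m (local-mean s D f v R L s≤D p D≤fv 2≤f av aR c cv))
           (local-mean s D f v R L s≤D p D≤fv 2≤f av aR (c ∖ x) cxv) ⟩
    m * W f 0 c K + W f 0 (c ∖ x) K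
      ≤⟨ +-monoʳ-≤ (m * W f 0 c K) (m≤n+m _ (f x * Z (c ∖ x) K)) ⟩
    m * W f 0 c K + (f x * Z (c ∖ x) K + W f 0 (c ∖ x) K)
      ≡⟨ cong (m * W f 0 c K +_) (W-shift f (f x) (c ∖ x) K) ⟨
    m * W f 0 c K + W f (f x) (c ∖ x) K ∎
    where
    open ≤-Reasoning
    K = R ++ v ∷ L
    lem : ∀ s m z w → s * (m * z + w) ≡ m * (s * z) + s * w
    lem = solve-∀
    cxv : (c ∖ x) v ≡ true
    cxv rewrite cv | a-sym x v | ax = refl

-- Words and Hamming balls

module _ {A : Set} where

  ∑-cong : ∀ (L : List A) {f g : A → ℕ} → (∀ x → f x ≡ g x) → ∑ L f ≡ ∑ L g
  ∑-cong L e = cong sum (map-cong e L)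

  ∑-mono : ∀ (L : List A) {f g : A → ℕ} → (∀ x → f x ≤ g x) → ∑ L f ≤ ∑ L g
  ∑-mono []      p = z≤n
  ∑-mono (x ∷ L) p = +-mono-≤ (p x) (∑-mono L p)

  ∑-+ : ∀ (L : List A) f g → ∑ L (λ x → f x + g x) ≡ ∑ L f + ∑ L g
  ∑-+ []      f g = refl
  ∑-+ (x ∷ L) f g = trans (cong (f x + g x +_) (∑-+ L f g)) (+-interchange (f x) (g x) _ _)

  ∑-* : ∀ k (L : List A) f → ∑ L (λ x → k * f x) ≡ k * ∑ L f
  ∑-* k []      f = sym (*-zeroʳ k)
  ∑-* k (x ∷ L) f = trans (cong (k * f x +_) (∑-* k L f)) (sym (*-distribˡ-+ k (f x) _))

  ∑-const : ∀ k (L : List A) → ∑ L (λ _ → k) ≡ k * length L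
  ∑-const k []      = sym (*-zeroʳ k)
  ∑-const k (x ∷ L) = trans (cong (k +_) (∑-const k L)) (sym (*-suc k (length L)))

  ∑-++ : ∀ (K L : List A) f → ∑ (K ++ L) f ≡ ∑ K f + ∑ L f
  ∑-++ K L f = trans (cong sum (map-++ f K L)) (sum-++ (map f K) (map f L))

  ∑-↭ : ∀ {K L : List A} f → K ↭ L → ∑ K f ≡ ∑ L f
  ∑-↭ f p = sum-↭ (map⁺ f p)

  ∑-filter : ∀ p (L : List A) f → ∑ (filterᵇ p L) f ≡ ∑ L (λ x → 𝟙 (p x) * f x)
  ∑-filter p []      f = refl
  ∑-filter p (x ∷ L) f with p x
  ... | false = ∑-filter p L f
  ... | true  = cong₂ _+_ (sym (+-identityʳ (f x))) (∑-filter p L f)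

  length-filter : ∀ p (L : List A) → length (filterᵇ p L) ≡ ∑ L (λ x → 𝟙 (p x))
  length-filter p []      = refl
  length-filter p (x ∷ L) with p x
  ... | false = length-filter p L
  ... | true  = cong suc (length-filter p L)

  filter-split : ∀ p (L : List A) → L ↭ filterᵇ p L ++ filterᵇ (not ∘ p) L
  filter-split p []      = ↭.refl
  filter-split p (x ∷ L) with p x
  ... | true  = ↭.prep x (filter-split p L)
  ... | false = ↭.trans (↭.prep x (filter-split p L)) (↭-sym (shift x (filterᵇ p L) _))

  all-filter : ∀ p (L : List A) → All (λ x → p x ≡ true) (filterᵇ p L)
  all-filter p []      = []
  all-filter p (x ∷ L) with p x in eq
  ... | true  = eq ∷ all-filter p L
  ... | false = all-filter p L

∑-swap : ∀ {A B : Set} (K : List A) (L : List B) (f : A → B → ℕ) →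
  ∑ K (λ x → ∑ L (f x)) ≡ ∑ L (λ y → ∑ K (λ x → f x y))
∑-swap []      L f = sym (∑-const 0 L)
∑-swap (x ∷ K) L f = trans (cong (∑ L (f x) +_) (∑-swap K L f)) (sym (∑-+ L (f x) _))

∑-upTo-suc : ∀ k f → ∑ (upTo (suc k)) f ≡ f 0 + ∑ (upTo k) (f ∘ suc)
∑-upTo-suc k f = cong (λ L → f 0 + sum L) (trans (map-applyUpTo suc f k) (sym (map-applyUpTo id (f ∘ suc) k)))

∑-upTo-mono : ∀ k {f g : ℕ → ℕ} → (∀ t → t < k → f t ≤ g t) → ∑ (upTo k) f ≤ ∑ (upTo k) g
∑-upTo-mono zero    p = z≤n
∑-upTo-mono (suc k) {f} {g} p rewrite ∑-upTo-suc k f | ∑-upTo-suc k g =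
  +-mono-≤ (p 0 z<s) (∑-upTo-mono k (λ t t<k → p (suc t) (s<s t<k)))

∑-upTo-member : ∀ k f t → t < k → f t ≤ ∑ (upTo k) f
∑-upTo-member (suc k) f zero    p rewrite ∑-upTo-suc k f = m≤m+n (f 0) _
∑-upTo-member (suc k) f (suc t) p rewrite ∑-upTo-suc k f =
  ≤-trans (∑-upTo-member k (f ∘ suc) t (s<s⁻¹ p)) (m≤n+m _ _)

∑-allFin-suc : ∀ k (f : Fin (suc k) → ℕ) → ∑ (allFin (suc k)) f ≡ f zero + ∑ (allFin k) (f ∘ suc)
∑-allFin-suc k f = cong (λ L → f zero + sum L) (trans (map-tabulate suc f) (sym (map-tabulate id (f ∘ suc))))

∑-allFin-const : ∀ k c → ∑ (allFin k) (λ _ → c) ≡ k * c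
∑-allFin-const zero    c = refl
∑-allFin-const (suc k) c = trans (∑-allFin-suc k (λ _ → c)) (cong (c +_) (∑-allFin-const k c))

-- The sums differ only in the term at `a`; adding the opposite term to each side avoids
-- subtraction.
∑-update : ∀ {k} (a : Fin k) (f g : Fin k → ℕ) → (∀ b → does (a ≟F b) ≡ false → f b ≡ g b) →
  ∑ (allFin k) f + g a ≡ ∑ (allFin k) g + f a
∑-update {suc k} zero f g e rewrite ∑-allFin-suc k f | ∑-allFin-suc k g
  | ∑-cong (allFin k) {f ∘ suc} {g ∘ suc} (λ b → e (suc b) refl) = lem (f zero) (g zero) _
  where lem : ∀ a b c → a + c + b ≡ b + c + a
        lem = solve-∀
∑-update {suc k} (suc a) f g e rewrite ∑-allFin-suc k f | ∑-allFin-suc k g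
  | e zero refl = trans (+-assoc (g zero) _ _)
    (trans (cong (g zero +_) (∑-update a (f ∘ suc) (g ∘ suc) (λ b → e (suc b)))) (sym (+-assoc (g zero) _ _)))

≟F-diag : ∀ {k} (a : Fin k) → does (a ≟F a) ≡ true
≟F-diag zero    = refl
≟F-diag (suc a) = ≟F-diag a

∑-one-point : ∀ {u} (a : Fin (suc u)) (h : Bool → ℕ) →
  ∑ (allFin (suc u)) (λ b → h (does (a ≟F b))) ≡ h true + u * h false
∑-one-point {u} a h = +-cancelʳ-≡ (h false) _ _ (begin
  ∑ (allFin (suc u)) (λ b → h (does (a ≟F b))) + h false
    ≡⟨ ∑-update a (λ b → h (does (a ≟F b))) (λ _ → h false) (λ b → cong h) ⟩
  ∑ (allFin (suc u)) (λ _ → h false) + h (does (a ≟F a))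
    ≡⟨ cong₂ _+_ (∑-allFin-const (suc u) (h false)) (cong h (≟F-diag a)) ⟩
  suc u * h false + h true
    ≡⟨ lem u (h true) (h false) ⟩
  h true + u * h false + h false ∎)
  where
  open ≡-Reasoning
  lem : ∀ u s t → (1 + u) * t + s ≡ s + u * t + t
  lem = solve-∀

words : ∀ q n → List (Vec (Fin q) n)
words q zero    = [] ∷ []
words q (suc n) = cartesianProductWith _∷_ (allFin q) (words q n)

∑-words-suc : ∀ q n (f : Vec (Fin q) (suc n) → ℕ) →
  ∑ (words q (suc n)) f ≡ ∑ (allFin q) (λ b → ∑ (words q n) (λ x → f (b ∷ x)))
∑-words-suc q n f = go (allFin q)
  where
  go : ∀ L → ∑ (cartesianProductWith _∷_ L (words q n)) f ≡ ∑ L (λ b → ∑ (words q n) (λ x → f (b ∷ x)))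
  go []      = refl
  go (b ∷ L) = trans (∑-++ (map (b ∷_) (words q n)) _ f)
    (cong₂ _+_ (cong sum (sym (map-∘ (words q n)))) (go L))

length-words : ∀ q n → length (words q n) ≡ q ^ n
length-words q n = trans (sym (trans (∑-const 1 (words q n)) (+-identityʳ _))) (go n)
  where
  go : ∀ n → ∑ (words q n) (λ _ → 1) ≡ q ^ n
  go zero    = refl
  go (suc n) = trans (∑-words-suc q n (λ _ → 1))
    (trans (∑-cong (allFin q) (λ _ → go n)) (∑-allFin-const q (q ^ n)))

-- Radius 0 serves as the equality test, so that counting copies of a word is a case of `ball-size`.
near : ∀ {q n} → ℕ → Vec (Fin q) n → Vec (Fin q) n → Bool
near r x y = hamming x y ≤ᵇ r

-- Pascal's rule, in the shape of a ball split by first letter: it agrees with the centre, or is one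
-- of q - 1 others and uses up one unit of radius.
V-suc : ∀ q n r → V q (suc n) (suc r) ≡ V q n (suc r) + (q ∸ 1) * V q n r
V-suc q n r = begin
  V q (suc n) (suc r)
    ≡⟨ ∑-upTo-suc (suc r) (λ i → (suc n choose i) * (q ∸ 1) ^ i) ⟩
  1 + ∑ (upTo (suc r)) (λ i → (suc n choose suc i) * (q ∸ 1) ^ suc i)
    ≡⟨ cong suc (∑-cong (upTo (suc r)) λ i →
         trans (cong (_* (q ∸ 1) ^ suc i) (sym (nCk+nC[k+1]≡[n+1]C[k+1] n i)))
               (lem (n choose i) (n choose suc i) (q ∸ 1) ((q ∸ 1) ^ i))) ⟩
  1 + ∑ (upTo (suc r)) (λ i → (n choose suc i) * (q ∸ 1) ^ suc i + (q ∸ 1) * ((n choose i) * (q ∸ 1) ^ i))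
    ≡⟨ cong suc (∑-+ (upTo (suc r)) (λ i → (n choose suc i) * (q ∸ 1) ^ suc i) (λ i → (q ∸ 1) * ((n choose i) * (q ∸ 1) ^ i))) ⟩
  1 + (∑ (upTo (suc r)) (λ i → (n choose suc i) * (q ∸ 1) ^ suc i)
        + ∑ (upTo (suc r)) (λ i → (q ∸ 1) * ((n choose i) * (q ∸ 1) ^ i)))
    ≡⟨ cong₂ _+_ (sym (∑-upTo-suc (suc r) (λ i → (n choose i) * (q ∸ 1) ^ i)))
         (∑-* (q ∸ 1) (upTo (suc r)) (λ i → (n choose i) * (q ∸ 1) ^ i)) ⟩
  V q n (suc r) + (q ∸ 1) * V q n r ∎
  where
  open ≡-Reasoning
  lem : ∀ a b u t → (a + b) * (u * t) ≡ b * (u * t) + u * (a * t)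
  lem = solve-∀

V-zeroˡ : ∀ q r → V q 0 r ≡ 1
V-zeroˡ q zero    = refl
V-zeroˡ q (suc r) = trans (∑-upTo-suc (suc r) (λ i → (0 choose i) * (q ∸ 1) ^ i))
  (cong suc (∑-const 0 (upTo (suc r))))

ball-size : ∀ u n r (v : Vec (Fin (suc u)) n) → ∑ (words (suc u) n) (λ x → 𝟙 (near r v x)) ≡ V (suc u) n r
ball-size u zero    r []      = sym (V-zeroˡ (suc u) r)
ball-size u (suc n) r (a ∷ v) = begin
  ∑ (words (suc u) (suc n)) (λ x → 𝟙 (near r (a ∷ v) x))
    ≡⟨ ∑-words-suc (suc u) n _ ⟩
  ∑ (allFin (suc u)) (λ b → h (does (a ≟F b)))
    ≡⟨ ∑-one-point a h ⟩
  h true + u * h false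
    ≡⟨ step r ⟩
  V (suc u) (suc n) r ∎
  where
  open ≡-Reasoning
  h : Bool → ℕ
  h e = ∑ (words (suc u) n) (λ x → 𝟙 ((if e then 0 else 1) + hamming v x ≤ᵇ r))
  suc≤ᵇsuc : ∀ a b → (suc a ≤ᵇ suc b) ≡ (a ≤ᵇ b)
  suc≤ᵇsuc zero    b = refl
  suc≤ᵇsuc (suc a) b = refl
  step : ∀ r → ∑ (words (suc u) n) (λ x → 𝟙 (hamming v x ≤ᵇ r)) +
               u * ∑ (words (suc u) n) (λ x → 𝟙 (suc (hamming v x) ≤ᵇ r)) ≡ V (suc u) (suc n) r
  step zero    = trans (cong₂ _+_ (ball-size u n 0 v) (trans (cong (u *_) (∑-const 0 (words (suc u) n))) (*-zeroʳ u))) refl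
  step (suc r) = trans (cong₂ _+_ (ball-size u n (suc r) v)
    (cong (u *_) (trans (∑-cong (words (suc u) n) (λ x → cong 𝟙 (suc≤ᵇsuc (hamming v x) r))) (ball-size u n r v))))
    (sym (V-suc (suc u) n r))

hamming-refl : ∀ {q n} (x : Vec (Fin q) n) → hamming x x ≡ 0
hamming-refl []      = refl
hamming-refl (a ∷ x) rewrite ≟F-diag a = hamming-refl x

≟F-comm : ∀ {k} (a b : Fin k) → does (a ≟F b) ≡ does (b ≟F a)
≟F-comm zero    zero    = refl
≟F-comm zero    (suc b) = refl
≟F-comm (suc a) zero    = refl
≟F-comm (suc a) (suc b) = ≟F-comm a b

hamming-comm : ∀ {q n} (x y : Vec (Fin q) n) → hamming x y ≡ hamming y x
hamming-comm []      []      = refl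
hamming-comm (a ∷ x) (b ∷ y) = cong₂ (λ e d → (if e then 0 else 1) + d) (≟F-comm a b) (hamming-comm x y)

hamming-zero : ∀ {q n} (x y : Vec (Fin q) n) → hamming x y ≡ 0 → x ≡ y
hamming-zero []      []      e = refl
hamming-zero (a ∷ x) (b ∷ y) e with a ≟F b
... | yes refl = cong (a ∷_) (hamming-zero x y e)

near-refl : ∀ {q n} r (x : Vec (Fin q) n) → near r x x ≡ true
near-refl r x rewrite hamming-refl x = refl

near-sym : ∀ {q n} r (x y : Vec (Fin q) n) → near r x y ≡ near r y x
near-sym r x y = cong (_≤ᵇ r) (hamming-comm x y)

near-0 : ∀ {q n} (x y : Vec (Fin q) n) → near 0 x y ≡ true → x ≡ y
near-0 x y e with hamming x y in eq
... | zero = hamming-zero x y eq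

-- Pairs of words by their coordinate patterns

-- Coordinate patterns of a pair x, y relative to a centre v.
data Kind : Set where
  none onlyʸ onlyˣ same diff : Kind

-- The arguments tell whether v = x, v = y and x = y at the coordinate; the last counts only where
-- both words leave v.
kind : Bool → Bool → Bool → Kind
kind true  true  _     = none
kind true  false _     = onlyʸ
kind false true  _     = onlyˣ
kind false false true  = same
kind false false false = diff

-- With q = 2 + p the five kinds arise from 1, q - 1, q - 1, q - 1 and (q - 1)(q - 2) pairs of
-- letters. These are the weights later given to `Count`.
∑-kinds : ∀ p (v : Fin (2 + p)) (h : Kind → ℕ) →
  ∑ (allFin (2 + p)) (λ a → ∑ (allFin (2 + p)) (λ b → h (kind (does (v ≟F a)) (does (v ≟F b)) (does (a ≟F b)))))
  ≡ h none + suc p * h onlyʸ + suc p * (h onlyˣ + h same + p * h diff)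
∑-kinds p v h = trans (∑-cong (allFin (2 + p)) row) (∑-one-point v H)
  where
  open ≡-Reasoning
  H : Bool → ℕ
  H true  = h none + suc p * h onlyʸ
  H false = h onlyˣ + h same + p * h diff
  g₁ g₂ : Bool → ℕ
  g₁ e = if e then h none else h onlyʸ
  g₂ e = if e then h onlyˣ else h diff
  row : ∀ a → ∑ (allFin (2 + p)) (λ b → h (kind (does (v ≟F a)) (does (v ≟F b)) (does (a ≟F b)))) ≡ H (does (v ≟F a))
  row a with does (v ≟F a) in eq
  ... | true  = trans (∑-cong (allFin (2 + p)) (λ b → lem (does (v ≟F b)) (does (a ≟F b)))) (∑-one-point v g₁)
    where lem : ∀ e e′ → h (kind true e e′) ≡ g₁ e
          lem true  _ = refl
          lem false _ = refl
  -- The summand follows `g₂` except at b = a, where it is `same` instead of `diff`; `∑-update`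
  -- exchanges that one term.
  ... | false = +-cancelʳ-≡ (h diff) _ _ (begin
    ∑ (allFin (2 + p)) (λ b → h (kind false (does (v ≟F b)) (does (a ≟F b)))) + h diff
      ≡⟨ cong (λ e → ∑ (allFin (2 + p)) (λ b → h (kind false (does (v ≟F b)) (does (a ≟F b)))) + g₂ e) eq ⟨
    ∑ (allFin (2 + p)) (λ b → h (kind false (does (v ≟F b)) (does (a ≟F b)))) + g₂ (does (v ≟F a))
      ≡⟨ ∑-update a (λ b → h (kind false (does (v ≟F b)) (does (a ≟F b)))) (λ b → g₂ (does (v ≟F b)))
           (λ b e → trans (cong (λ e′ → h (kind false (does (v ≟F b)) e′)) e) (off (does (v ≟F b)))) ⟩
    ∑ (allFin (2 + p)) (λ b → g₂ (does (v ≟F b))) + h (kind false (does (v ≟F a)) (does (a ≟F a)))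
      ≡⟨ cong₂ _+_ (∑-one-point v g₂) (cong₂ (λ e e′ → h (kind false e e′)) eq (≟F-diag a)) ⟩
    h onlyˣ + suc p * h diff + h same
      ≡⟨ lem (h onlyˣ) p (h diff) (h same) ⟩
    h onlyˣ + h same + p * h diff + h diff ∎)
    where off : ∀ e → h (kind false e false) ≡ g₂ e
          off true  = refl
          off false = refl
          lem : ∀ x p d s → x + (1 + p) * d + s ≡ x + s + p * d + d
          lem = solve-∀

-- j and k are the paper's indices; xo and yo are its w − c and i − c.
record Profile : Set where
  constructor ⟨_,_,_,_,_⟩
  field j k xo yo o : ℕ

open Profile

bump : Kind → Profile → Profile
bump none  P = record P { o = suc (o P) }
bump onlyʸ P = record P { yo = suc (yo P) }
bump onlyˣ P = record P { xo = suc (xo P) }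
bump same  P = record P { j = suc (j P) }
bump diff  P = record P { k = suc (k P) }

profile : ∀ {q n} → Vec (Fin q) n → Vec (Fin q) n → Vec (Fin q) n → Profile
profile []      []      []      = ⟨ 0 , 0 , 0 , 0 , 0 ⟩
profile (c ∷ v) (a ∷ x) (b ∷ y) = bump (kind (does (c ≟F a)) (does (c ≟F b)) (does (a ≟F b))) (profile v x y)

profile-total : ∀ {q n} (v x y : Vec (Fin q) n) → let P = profile v x y in j P + k P + (xo P + (yo P + o P)) ≡ n
profile-total []      []      []      = refl
profile-total (c ∷ v) (a ∷ x) (b ∷ y) =
  trans (lem (kind (does (c ≟F a)) (does (c ≟F b)) (does (a ≟F b))) (profile v x y)) (cong suc (profile-total v x y))
  where
  lem : ∀ κ P → let Q = bump κ P in
    j Q + k Q + (xo Q + (yo Q + o Q)) ≡ suc (j P + k P + (xo P + (yo P + o P)))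
  lem none  P = go (j P + k P) (xo P) (yo P) (o P)
    where go : ∀ a b c d → a + (b + (c + suc d)) ≡ suc (a + (b + (c + d)))
          go = solve-∀
  lem onlyʸ P = go (j P + k P) (xo P) (yo P) (o P)
    where go : ∀ a b c d → a + (b + suc (c + d)) ≡ suc (a + (b + (c + d)))
          go = solve-∀
  lem onlyˣ P = +-suc (j P + k P) _
  lem same  P = refl
  lem diff  P = cong (_+ (xo P + (yo P + o P))) (+-suc (j P) (k P))

profile-hamming : ∀ {q n} (v x y : Vec (Fin q) n) → let P = profile v x y in
  hamming v x ≡ xo P + (j P + k P) × hamming v y ≡ yo P + (j P + k P) × hamming x y ≡ xo P + yo P + k P
profile-hamming [] [] [] = refl , refl , refl
profile-hamming (c ∷ v) (a ∷ x) (b ∷ y) with profile v x y | profile-hamming v x y | c ≟F a | c ≟F b | a ≟F b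
... | P | p , q , r | yes _    | yes _    | yes _  = p , q , r
... | P | p , q , r | yes _    | no _     | no _   =
  p , cong suc q , trans (cong suc r) (cong (_+ k P) (sym (+-suc (xo P) (yo P))))
... | P | p , q , r | no _     | yes _    | no _   = cong suc p , q , cong suc r
... | P | p , q , r | no _     | no _     | yes _  =
  trans (cong suc p) (sym (+-suc (xo P) _)) , trans (cong suc q) (sym (+-suc (yo P) _)) , r
... | P | p , q , r | no _     | no _     | no _   =
  trans (cong suc p) (reassoc (xo P)) , trans (cong suc q) (reassoc (yo P)) , trans (cong suc r) (sym (+-suc (xo P + yo P) _))
  where reassoc : ∀ a → suc (a + (j P + k P)) ≡ a + (j P + suc (k P))
        reassoc a = trans (sym (+-suc a _)) (cong (a +_) (sym (+-suc (j P) (k P))))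
... | _ | _ | yes refl | yes refl | no f   = contradiction refl f
... | _ | _ | yes refl | no f     | yes e  = contradiction e f
... | _ | _ | no f     | yes refl | yes e  = contradiction (sym e) f

-- Pairs with a given profile and multinomial coefficients

matches : Profile → Profile → Bool
matches Q P = (j P ≡ᵇ j Q) ∧ ((k P ≡ᵇ k Q) ∧ ((xo P ≡ᵇ xo Q) ∧ ((yo P ≡ᵇ yo Q) ∧ (o P ≡ᵇ o Q))))

≡ᵇ-refl : ∀ n → (n ≡ᵇ n) ≡ true
≡ᵇ-refl zero    = refl
≡ᵇ-refl (suc n) = ≡ᵇ-refl n

matches-refl : ∀ P → matches P P ≡ true
matches-refl P rewrite ≡ᵇ-refl (j P) | ≡ᵇ-refl (k P) | ≡ᵇ-refl (xo P) | ≡ᵇ-refl (yo P) = ≡ᵇ-refl (o P)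

-- The value 0 at 0 says that a profile without coordinates of some kind cannot begin with one.
atPred : (ℕ → ℕ) → ℕ → ℕ
atPred f zero    = 0
atPred f (suc m) = f m

-- `count` recurses on the kind of the first coordinate, which links two readings: a number of pairs
-- of words for the weights of `∑-kinds`, and a multinomial coefficient times powers of the weights.
-- Kind `none` has weight 1.
module Count (wˢ wᵈ wˣ wʸ : ℕ) where

  count : ℕ → Profile → ℕ
  count zero    Q = 𝟙 (matches Q ⟨ 0 , 0 , 0 , 0 , 0 ⟩)
  count (suc n) Q =
    atPred (λ t → count n (record Q { o = t })) (o Q)
    + wʸ * atPred (λ t → count n (record Q { yo = t })) (yo Q)
    + (wˣ * atPred (λ t → count n (record Q { xo = t })) (xo Q)
      + wˢ * atPred (λ t → count n (record Q { j = t })) (j Q)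
      + wᵈ * atPred (λ t → count n (record Q { k = t })) (k Q))

  factorials : Profile → ℕ
  factorials Q = (j Q ! * k Q !) * (xo Q ! * (yo Q ! * o Q !))

  weight : Profile → ℕ
  weight Q = (wˢ ^ j Q * wᵈ ^ k Q) * (wˣ ^ xo Q * wʸ ^ yo Q)

  -- Pascal's rule for multinomial coefficients with denominators cleared: the summand that lowers
  -- an entry t of `Q` becomes t times `n ! * weight Q`, and the entries add up to `suc n`.
  count-multinomial : ∀ n Q → j Q + k Q + (xo Q + (yo Q + o Q)) ≡ n → count n Q * factorials Q ≡ n ! * weight Q
  count-multinomial zero    ⟨ zero , zero , zero , zero , zero ⟩ e = refl
  count-multinomial (suc n) Q@(⟨ j , k , x , y , o ⟩) e = begin
    (c₀ + wʸ * c₁ + (wˣ * c₂ + wˢ * c₃ + wᵈ * c₄)) * D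
      ≡⟨ distrib c₀ (wʸ * c₁) (wˣ * c₂) (wˢ * c₃) (wᵈ * c₄) D ⟩
    c₀ * D + wʸ * c₁ * D + (wˣ * c₂ * D + wˢ * c₃ * D + wᵈ * c₄ * D)
      ≡⟨ cong₂ _+_ (cong₂ _+_ (s₀ o e) (s₁ y e)) (cong₂ _+_ (cong₂ _+_ (s₂ x e) (s₃ j e)) (s₄ k e)) ⟩
    o * N + y * N + (x * N + j * N + k * N)
      ≡⟨ collect o y x j k N ⟩
    (j + k + (x + (y + o))) * N
      ≡⟨ cong (_* N) e ⟩
    suc n * N
      ≡⟨ *-assoc (suc n) (n !) (weight Q) ⟨
    suc n ! * weight Q ∎
    where
    open ≡-Reasoning
    D = factorials Q
    N = n ! * weight Q
    c₀ = atPred (λ t → count n (record Q { o = t })) o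
    c₁ = atPred (λ t → count n (record Q { yo = t })) y
    c₂ = atPred (λ t → count n (record Q { xo = t })) x
    c₃ = atPred (λ t → count n (record Q { j = t })) j
    c₄ = atPred (λ t → count n (record Q { k = t })) k
    distrib : ∀ a b c d e D → (a + b + (c + d + e)) * D ≡ a * D + b * D + (c * D + d * D + e * D)
    distrib = solve-∀
    collect : ∀ o y x j k N → o * N + y * N + (x * N + j * N + k * N) ≡ (j + k + (x + (y + o))) * N
    collect = solve-∀
    s₀ : ∀ t → j + k + (x + (y + t)) ≡ suc n →
      atPred (λ s → count n ⟨ j , k , x , y , s ⟩) t * factorials ⟨ j , k , x , y , t ⟩ ≡ t * (n ! * weight ⟨ j , k , x , y , t ⟩)
    s₀ zero    e = refl
    s₀ (suc t) e = trans before
      (trans (cong (suc t *_) (count-multinomial n ⟨ j , k , x , y , t ⟩ (suc-injective (trans (sym total-suc) e)))) after)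
      where
      total-suc : j + k + (x + (y + suc t)) ≡ suc (j + k + (x + (y + t)))
      total-suc = lem j k x y o t
        where lem : ∀ j k x y o t → j + k + (x + (y + (1 + t))) ≡ 1 + (j + k + (x + (y + t)))
              lem = solve-∀
      before : count n ⟨ j , k , x , y , t ⟩ * factorials ⟨ j , k , x , y , suc t ⟩ ≡ suc t * (count n ⟨ j , k , x , y , t ⟩ * factorials ⟨ j , k , x , y , t ⟩)
      before = lem t (count n ⟨ j , k , x , y , t ⟩) (j !) (k !) (x !) (y !) (t !)
        where lem : ∀ t c fj fk fx fy fo → c * ((fj * fk) * (fx * (fy * ((1 + t) * fo)))) ≡ (1 + t) * (c * ((fj * fk) * (fx * (fy * fo))))
              lem = solve-∀
      after : suc t * (n ! * weight ⟨ j , k , x , y , t ⟩) ≡ suc t * (n ! * weight ⟨ j , k , x , y , suc t ⟩)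
      after = refl
    s₁ : ∀ t → j + k + (x + (t + o)) ≡ suc n →
      wʸ * atPred (λ s → count n ⟨ j , k , x , s , o ⟩) t * factorials ⟨ j , k , x , t , o ⟩ ≡ t * (n ! * weight ⟨ j , k , x , t , o ⟩)
    s₁ zero    e = cong (_* factorials ⟨ j , k , x , 0 , o ⟩) (*-zeroʳ wʸ)
    s₁ (suc t) e = trans before
      (trans (cong (wʸ * suc t *_) (count-multinomial n ⟨ j , k , x , t , o ⟩ (suc-injective (trans (sym total-suc) e)))) after)
      where
      total-suc : j + k + (x + (suc t + o)) ≡ suc (j + k + (x + (t + o)))
      total-suc = lem j k x y o t
        where lem : ∀ j k x y o t → j + k + (x + ((1 + t) + o)) ≡ 1 + (j + k + (x + (t + o)))
              lem = solve-∀
      before : wʸ * count n ⟨ j , k , x , t , o ⟩ * factorials ⟨ j , k , x , suc t , o ⟩ ≡ wʸ * suc t * (count n ⟨ j , k , x , t , o ⟩ * factorials ⟨ j , k , x , t , o ⟩)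
      before = lem wʸ t (count n ⟨ j , k , x , t , o ⟩) (j !) (k !) (x !) (t !) (o !)
        where lem : ∀ w t c fj fk fx fy fo → w * c * ((fj * fk) * (fx * (((1 + t) * fy) * fo))) ≡ w * (1 + t) * (c * ((fj * fk) * (fx * (fy * fo))))
              lem = solve-∀
      after : wʸ * suc t * (n ! * weight ⟨ j , k , x , t , o ⟩) ≡ suc t * (n ! * weight ⟨ j , k , x , suc t , o ⟩)
      after = lem wʸ t (n !) (wˢ ^ j) (wᵈ ^ k) (wˣ ^ x) (wʸ ^ t)
        where lem : ∀ w t c wj wk wx wy → w * (1 + t) * (c * ((wj * wk) * (wx * wy))) ≡ (1 + t) * (c * ((wj * wk) * (wx * (w * wy))))
              lem = solve-∀
    s₂ : ∀ t → j + k + (t + (y + o)) ≡ suc n →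
      wˣ * atPred (λ s → count n ⟨ j , k , s , y , o ⟩) t * factorials ⟨ j , k , t , y , o ⟩ ≡ t * (n ! * weight ⟨ j , k , t , y , o ⟩)
    s₂ zero    e = cong (_* factorials ⟨ j , k , 0 , y , o ⟩) (*-zeroʳ wˣ)
    s₂ (suc t) e = trans before
      (trans (cong (wˣ * suc t *_) (count-multinomial n ⟨ j , k , t , y , o ⟩ (suc-injective (trans (sym total-suc) e)))) after)
      where
      total-suc : j + k + (suc t + (y + o)) ≡ suc (j + k + (t + (y + o)))
      total-suc = lem j k x y o t
        where lem : ∀ j k x y o t → j + k + ((1 + t) + (y + o)) ≡ 1 + (j + k + (t + (y + o)))
              lem = solve-∀
      before : wˣ * count n ⟨ j , k , t , y , o ⟩ * factorials ⟨ j , k , suc t , y , o ⟩ ≡ wˣ * suc t * (count n ⟨ j , k , t , y , o ⟩ * factorials ⟨ j , k , t , y , o ⟩)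
      before = lem wˣ t (count n ⟨ j , k , t , y , o ⟩) (j !) (k !) (t !) (y !) (o !)
        where lem : ∀ w t c fj fk fx fy fo → w * c * ((fj * fk) * (((1 + t) * fx) * (fy * fo))) ≡ w * (1 + t) * (c * ((fj * fk) * (fx * (fy * fo))))
              lem = solve-∀
      after : wˣ * suc t * (n ! * weight ⟨ j , k , t , y , o ⟩) ≡ suc t * (n ! * weight ⟨ j , k , suc t , y , o ⟩)
      after = lem wˣ t (n !) (wˢ ^ j) (wᵈ ^ k) (wˣ ^ t) (wʸ ^ y)
        where lem : ∀ w t c wj wk wx wy → w * (1 + t) * (c * ((wj * wk) * (wx * wy))) ≡ (1 + t) * (c * ((wj * wk) * ((w * wx) * wy)))
              lem = solve-∀
    s₃ : ∀ t → t + k + (x + (y + o)) ≡ suc n →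
      wˢ * atPred (λ s → count n ⟨ s , k , x , y , o ⟩) t * factorials ⟨ t , k , x , y , o ⟩ ≡ t * (n ! * weight ⟨ t , k , x , y , o ⟩)
    s₃ zero    e = cong (_* factorials ⟨ 0 , k , x , y , o ⟩) (*-zeroʳ wˢ)
    s₃ (suc t) e = trans before
      (trans (cong (wˢ * suc t *_) (count-multinomial n ⟨ t , k , x , y , o ⟩ (suc-injective (trans (sym total-suc) e)))) after)
      where
      total-suc : suc t + k + (x + (y + o)) ≡ suc (t + k + (x + (y + o)))
      total-suc = lem j k x y o t
        where lem : ∀ j k x y o t → (1 + t) + k + (x + (y + o)) ≡ 1 + (t + k + (x + (y + o)))
              lem = solve-∀
      before : wˢ * count n ⟨ t , k , x , y , o ⟩ * factorials ⟨ suc t , k , x , y , o ⟩ ≡ wˢ * suc t * (count n ⟨ t , k , x , y , o ⟩ * factorials ⟨ t , k , x , y , o ⟩)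
      before = lem wˢ t (count n ⟨ t , k , x , y , o ⟩) (t !) (k !) (x !) (y !) (o !)
        where lem : ∀ w t c fj fk fx fy fo → w * c * ((((1 + t) * fj) * fk) * (fx * (fy * fo))) ≡ w * (1 + t) * (c * ((fj * fk) * (fx * (fy * fo))))
              lem = solve-∀
      after : wˢ * suc t * (n ! * weight ⟨ t , k , x , y , o ⟩) ≡ suc t * (n ! * weight ⟨ suc t , k , x , y , o ⟩)
      after = lem wˢ t (n !) (wˢ ^ t) (wᵈ ^ k) (wˣ ^ x) (wʸ ^ y)
        where lem : ∀ w t c wj wk wx wy → w * (1 + t) * (c * ((wj * wk) * (wx * wy))) ≡ (1 + t) * (c * (((w * wj) * wk) * (wx * wy)))
              lem = solve-∀
    s₄ : ∀ t → j + t + (x + (y + o)) ≡ suc n →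
      wᵈ * atPred (λ s → count n ⟨ j , s , x , y , o ⟩) t * factorials ⟨ j , t , x , y , o ⟩ ≡ t * (n ! * weight ⟨ j , t , x , y , o ⟩)
    s₄ zero    e = cong (_* factorials ⟨ j , 0 , x , y , o ⟩) (*-zeroʳ wᵈ)
    s₄ (suc t) e = trans before
      (trans (cong (wᵈ * suc t *_) (count-multinomial n ⟨ j , t , x , y , o ⟩ (suc-injective (trans (sym total-suc) e)))) after)
      where
      total-suc : j + suc t + (x + (y + o)) ≡ suc (j + t + (x + (y + o)))
      total-suc = lem j k x y o t
        where lem : ∀ j k x y o t → j + (1 + t) + (x + (y + o)) ≡ 1 + (j + t + (x + (y + o)))
              lem = solve-∀
      before : wᵈ * count n ⟨ j , t , x , y , o ⟩ * factorials ⟨ j , suc t , x , y , o ⟩ ≡ wᵈ * suc t * (count n ⟨ j , t , x , y , o ⟩ * factorials ⟨ j , t , x , y , o ⟩)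
      before = lem wᵈ t (count n ⟨ j , t , x , y , o ⟩) (j !) (t !) (x !) (y !) (o !)
        where lem : ∀ w t c fj fk fx fy fo → w * c * ((fj * ((1 + t) * fk)) * (fx * (fy * fo))) ≡ w * (1 + t) * (c * ((fj * fk) * (fx * (fy * fo))))
              lem = solve-∀
      after : wᵈ * suc t * (n ! * weight ⟨ j , t , x , y , o ⟩) ≡ suc t * (n ! * weight ⟨ j , suc t , x , y , o ⟩)
      after = lem wᵈ t (n !) (wˢ ^ j) (wᵈ ^ t) (wˣ ^ x) (wʸ ^ y)
        where lem : ∀ w t c wj wk wx wy → w * (1 + t) * (c * ((wj * wk) * (wx * wy))) ≡ (1 + t) * (c * ((wj * (w * wk)) * (wx * wy)))
              lem = solve-∀

matches-bump : ∀ κ P j′ k′ x′ y′ o′ → let Q = ⟨ j′ , k′ , x′ , y′ , o′ ⟩ in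
  𝟙 (matches Q (bump κ P)) ≡ (case κ of λ where
    none  → atPred (λ t → 𝟙 (matches (record Q { o = t }) P)) o′
    onlyʸ → atPred (λ t → 𝟙 (matches (record Q { yo = t }) P)) y′
    onlyˣ → atPred (λ t → 𝟙 (matches (record Q { xo = t }) P)) x′
    same  → atPred (λ t → 𝟙 (matches (record Q { j = t }) P)) j′
    diff  → atPred (λ t → 𝟙 (matches (record Q { k = t }) P)) k′)
matches-bump same  P zero     k′ x′ y′ o′ = refl
matches-bump same  P (suc j′) k′ x′ y′ o′ = refl
matches-bump diff  P j′ zero     x′ y′ o′ rewrite ∧-zeroʳ (j P ≡ᵇ j′) = refl
matches-bump diff  P j′ (suc k′) x′ y′ o′ = refl
matches-bump onlyˣ P j′ k′ zero     y′ o′ rewrite ∧-zeroʳ (k P ≡ᵇ k′) | ∧-zeroʳ (j P ≡ᵇ j′) = refl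
matches-bump onlyˣ P j′ k′ (suc x′) y′ o′ = refl
matches-bump onlyʸ P j′ k′ x′ zero     o′
  rewrite ∧-zeroʳ (xo P ≡ᵇ x′) | ∧-zeroʳ (k P ≡ᵇ k′) | ∧-zeroʳ (j P ≡ᵇ j′) = refl
matches-bump onlyʸ P j′ k′ x′ (suc y′) o′ = refl
matches-bump none  P j′ k′ x′ y′ zero
  rewrite ∧-zeroʳ (yo P ≡ᵇ y′) | ∧-zeroʳ (xo P ≡ᵇ x′) | ∧-zeroʳ (k P ≡ᵇ k′) | ∧-zeroʳ (j P ≡ᵇ j′) = refl
matches-bump none  P j′ k′ x′ y′ (suc o′) = refl

∑∑ : ∀ {A : Set} → List A → (A → A → ℕ) → ℕ
∑∑ L f = ∑ L (λ x → ∑ L (f x))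

∑∑-atPred : ∀ {A : Set} (L : List A) (f : ℕ → A → A → ℕ) m →
  ∑∑ L (λ x y → atPred (λ t → f t x y) m) ≡ atPred (λ t → ∑∑ L (f t)) m
∑∑-atPred L f zero    = trans (∑-cong L (λ _ → ∑-const 0 L)) (∑-const 0 L)
∑∑-atPred L f (suc m) = refl

∑∑-words-suc : ∀ q n (f : Vec (Fin q) (suc n) → Vec (Fin q) (suc n) → ℕ) →
  ∑∑ (words q (suc n)) f ≡ ∑∑ (allFin q) (λ a b → ∑∑ (words q n) (λ x y → f (a ∷ x) (b ∷ y)))
∑∑-words-suc q n f = begin
  ∑∑ (words q (suc n)) f
    ≡⟨ ∑-words-suc q n _ ⟩
  ∑ (allFin q) (λ a → ∑ (words q n) (λ x → ∑ (words q (suc n)) (f (a ∷ x))))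
    ≡⟨ ∑-cong (allFin q) (λ a → ∑-cong (words q n) (λ x → ∑-words-suc q n (f (a ∷ x)))) ⟩
  ∑ (allFin q) (λ a → ∑ (words q n) (λ x → ∑ (allFin q) (λ b → ∑ (words q n) (λ y → f (a ∷ x) (b ∷ y)))))
    ≡⟨ ∑-cong (allFin q) (λ a → ∑-swap (words q n) (allFin q) (λ x b → ∑ (words q n) (λ y → f (a ∷ x) (b ∷ y)))) ⟩
  ∑∑ (allFin q) (λ a b → ∑∑ (words q n) (λ x y → f (a ∷ x) (b ∷ y))) ∎
  where open ≡-Reasoning

module _ (p : ℕ) where

  open Count (suc p) (suc p * p) (suc p) (suc p)

  profile-count : ∀ n (v : Vec (Fin (2 + p)) n) Q → ∑∑ (words (2 + p) n) (λ x y → 𝟙 (matches Q (profile v x y))) ≡ count n Q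
  profile-count zero    []      Q = trans (+-identityʳ _) (+-identityʳ _)
  profile-count (suc n) (c ∷ v) Q@(⟨ j′ , k′ , x′ , y′ , o′ ⟩) = begin
    ∑∑ (words (2 + p) (suc n)) (λ x y → 𝟙 (matches Q (profile (c ∷ v) x y)))
      ≡⟨ ∑∑-words-suc (2 + p) n _ ⟩
    ∑∑ (allFin (2 + p)) (λ a b → h (kind (does (c ≟F a)) (does (c ≟F b)) (does (a ≟F b))))
      ≡⟨ ∑-kinds p c h ⟩
    h none + suc p * h onlyʸ + suc p * (h onlyˣ + h same + p * h diff)
      ≡⟨ lem p (h none) (h onlyʸ) (h onlyˣ) (h same) (h diff) ⟩
    h none + suc p * h onlyʸ + (suc p * h onlyˣ + suc p * h same + suc p * p * h diff)
      ≡⟨ cong₂ _+_ (cong₂ _+_ h₀ (cong (suc p *_) h₁))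
           (cong₂ _+_ (cong₂ _+_ (cong (suc p *_) h₂) (cong (suc p *_) h₃)) (cong (suc p * p *_) h₄)) ⟩
    count (suc n) Q ∎
    where
    open ≡-Reasoning
    h : Kind → ℕ
    h κ = ∑∑ (words (2 + p) n) (λ x y → 𝟙 (matches Q (bump κ (profile v x y))))
    lem : ∀ p a b c d e → a + (1 + p) * b + (1 + p) * (c + d + p * e)
      ≡ a + (1 + p) * b + ((1 + p) * c + (1 + p) * d + (1 + p) * p * e)
    lem = solve-∀
    step : ∀ κ (R : ℕ → Profile) m →
      (∀ P → 𝟙 (matches Q (bump κ P)) ≡ atPred (λ t → 𝟙 (matches (R t) P)) m) → h κ ≡ atPred (λ t → count n (R t)) m
    step κ R m e = begin
      h κ
        ≡⟨ ∑-cong (words (2 + p) n) (λ x → ∑-cong (words (2 + p) n) (λ y → e (profile v x y))) ⟩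
      ∑∑ (words (2 + p) n) (λ x y → atPred (λ t → 𝟙 (matches (R t) (profile v x y))) m)
        ≡⟨ ∑∑-atPred (words (2 + p) n) (λ t x y → 𝟙 (matches (R t) (profile v x y))) m ⟩
      atPred (λ t → ∑∑ (words (2 + p) n) (λ x y → 𝟙 (matches (R t) (profile v x y)))) m
        ≡⟨ atPred-cong m ⟩
      atPred (λ t → count n (R t)) m ∎
      where
      atPred-cong : ∀ m → atPred (λ t → ∑∑ (words (2 + p) n) (λ x y → 𝟙 (matches (R t) (profile v x y)))) m
                        ≡ atPred (λ t → count n (R t)) m
      atPred-cong zero    = refl
      atPred-cong (suc m) = profile-count n v (R m)
    h₀ = step none  (λ t → record Q { o = t })  o′ (λ P → matches-bump none  P j′ k′ x′ y′ o′)
    h₁ = step onlyʸ (λ t → record Q { yo = t }) y′ (λ P → matches-bump onlyʸ P j′ k′ x′ y′ o′)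
    h₂ = step onlyˣ (λ t → record Q { xo = t }) x′ (λ P → matches-bump onlyˣ P j′ k′ x′ y′ o′)
    h₃ = step same  (λ t → record Q { j = t })  j′ (λ P → matches-bump same  P j′ k′ x′ y′ o′)
    h₄ = step diff  (λ t → record Q { k = t })  k′ (λ P → matches-bump diff  P j′ k′ x′ y′ o′)

factorials≢0 : ∀ j k x y o → NonZero ((j ! * k !) * (x ! * (y ! * o !)))
factorials≢0 j k x y o = m*n≢0 _ _ {{m*n≢0 _ _ {{j !≢0}} {{k !≢0}}}}
  {{m*n≢0 _ _ {{x !≢0}} {{m*n≢0 _ _ {{y !≢0}} {{o !≢0}}}}}}

-- With all weights 1 the recursion yields the quotient as a natural number, so the division in
-- `multinom` is exact.
multinom-count : ∀ n j k x y o → j + k + (x + (y + o)) ≡ n →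
  multinom n j k x y o ≡ Count.count 1 1 1 1 n ⟨ j , k , x , y , o ⟩
multinom-count n j k x y o e = trans (cong (λ N → (N / D) {{D≢0}}) n!≡) (m*n/n≡m _ D {{D≢0}})
  where
  open Count 1 1 1 1
  D = (j ! * k !) * (x ! * (y ! * o !))
  D≢0 = factorials≢0 j k x y o
  n!≡ : n ! ≡ count n ⟨ j , k , x , y , o ⟩ * D
  n!≡ = sym (trans (count-multinomial n ⟨ j , k , x , y , o ⟩ e) (trans (cong (n ! *_) one) (*-identityʳ (n !))))
    where one : (1 ^ j * 1 ^ k) * (1 ^ x * 1 ^ y) ≡ 1
          one rewrite ^-zeroˡ j | ^-zeroˡ k | ^-zeroˡ x | ^-zeroˡ y = refl

count≡term : ∀ p n j k x y o → j + k + (x + (y + o)) ≡ n →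
  Count.count (suc p) (suc p * p) (suc p) (suc p) n ⟨ j , k , x , y , o ⟩
  ≡ multinom n j k x y o * p ^ k * suc p ^ (j + k + (x + y))
count≡term p n j k x y o e = *-cancelʳ-≡ _ _ D {{factorials≢0 j k x y o}} (begin
  C.count n Q * D                          ≡⟨ C.count-multinomial n Q e ⟩
  n ! * C.weight Q                         ≡⟨ cong (_* C.weight Q) n!≡ ⟩
  multinom n j k x y o * D * C.weight Q    ≡⟨ cong (multinom n j k x y o * D *_) weight≡ ⟩
  multinom n j k x y o * D * (p ^ k * u ^ (j + k + (x + y)))
    ≡⟨ lem (multinom n j k x y o) D (p ^ k) _ ⟩
  multinom n j k x y o * p ^ k * u ^ (j + k + (x + y)) * D ∎)
  where
  open ≡-Reasoning
  u = suc p
  Q = ⟨ j , k , x , y , o ⟩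
  D = (j ! * k !) * (x ! * (y ! * o !))
  module C = Count u (u * p) u u
  module U = Count 1 1 1 1
  lem : ∀ m D a b → m * D * (a * b) ≡ m * a * b * D
  lem = solve-∀
  n!≡ : n ! ≡ multinom n j k x y o * D
  n!≡ = sym (begin
    multinom n j k x y o * D  ≡⟨ cong (_* D) (multinom-count n j k x y o e) ⟩
    U.count n Q * D           ≡⟨ U.count-multinomial n Q e ⟩
    n ! * U.weight Q          ≡⟨ cong (n ! *_) one ⟩
    n ! * 1                   ≡⟨ *-identityʳ (n !) ⟩
    n !                       ∎)
    where one : (1 ^ j * 1 ^ k) * (1 ^ x * 1 ^ y) ≡ 1
          one rewrite ^-zeroˡ j | ^-zeroˡ k | ^-zeroˡ x | ^-zeroˡ y = refl
  weight≡ : C.weight Q ≡ p ^ k * u ^ (j + k + (x + y))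
  weight≡ rewrite ^-distribʳ-* u p k | ^-distribˡ-+-* u (j + k) (x + y)
    | ^-distribˡ-+-* u j k | ^-distribˡ-+-* u x y = lem′ (u ^ j) (u ^ k) (p ^ k) _
    where lem′ : ∀ a b c d → (a * (b * c)) * d ≡ c * ((a * b) * d)
          lem′ = solve-∀

-- The index ranges of `eSum`

t<a∸b⇒b+t<a : ∀ {t} a b → t < a ∸ b → b + t < a
t<a∸b⇒b+t<a a       zero    l = l
t<a∸b⇒b+t<a (suc a) (suc b) l = s<s (t<a∸b⇒b+t<a a b l)

Σ-mono : ∀ lo hi {f g} → (∀ t → lo ≤ t → t ≤ hi → f t ≤ g t) → Σ[ lo to hi ] f ≤ Σ[ lo to hi ] g
Σ-mono lo hi p = ∑-upTo-mono (suc hi ∸ lo) λ t l →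
  p (lo + t) (m≤m+n lo t) (s≤s⁻¹ (t<a∸b⇒b+t<a (suc hi) lo l))

Σ-cong : ∀ lo hi {f g} → (∀ t → f t ≡ g t) → Σ[ lo to hi ] f ≡ Σ[ lo to hi ] g
Σ-cong lo hi e = ∑-cong (upTo (suc hi ∸ lo)) λ t → e (lo + t)

Σ-member : ∀ lo hi f t → lo ≤ t → t ≤ hi → f t ≤ Σ[ lo to hi ] f
Σ-member lo hi f t p q = subst (λ s → f s ≤ Σ[ lo to hi ] f) (m+[n∸m]≡n p)
  (∑-upTo-member (suc hi ∸ lo) (λ s → f (lo + s)) (t ∸ lo) (∸-monoˡ-< (s≤s q) p))

∑-Σ : ∀ {A : Set} (L : List A) lo hi (f : A → ℕ → ℕ) →
  ∑ L (λ x → Σ[ lo to hi ] (f x)) ≡ Σ[ lo to hi ] (λ t → ∑ L (λ x → f x t))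
∑-Σ L lo hi f = ∑-swap L (upTo (suc hi ∸ lo)) (λ x t → f x (lo + t))

module Box (n r : ℕ) where

  -- This limit on k merges two conditions: the distance w + i - 2j - k between the two words is at
  -- most r, and the number n + j + k - w - i of coordinates where both agree with the centre is not
  -- negative.
  lower : ℕ → ℕ → ℕ → ℕ
  lower w i j = (w + i) ∸ (j + ((r + j) ⊓ n))

  box₁ : (w i j : ℕ) → (ℕ → ℕ) → ℕ
  box₁ w i j f = Σ[ lower w i j to (w ⊓ i) ∸ j ] f

  box₂ : (w i : ℕ) → (ℕ → ℕ → ℕ) → ℕ
  box₂ w i f = Σ[ 0 to w ⊓ i ] λ j → box₁ w i j (f j)

  box₃ : (w : ℕ) → (ℕ → ℕ → ℕ → ℕ) → ℕ
  box₃ w f = Σ[ 1 to r ] λ i → box₂ w i (f i)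

  box : (ℕ → ℕ → ℕ → ℕ → ℕ) → ℕ
  box f = Σ[ 1 to r ] λ w → box₃ w (f w)

  record InBox (w i j k : ℕ) : Set where
    constructor inBox
    field
      1≤w : 1 ≤ w
      w≤r : w ≤ r
      1≤i : 1 ≤ i
      i≤r : i ≤ r
      j≤a : j ≤ w ⊓ i
      b≤k : lower w i j ≤ k
      k≤a∸j : k ≤ (w ⊓ i) ∸ j

  box-mono : ∀ {f g} → (∀ w i j k → InBox w i j k → f w i j k ≤ g w i j k) → box f ≤ box g
  box-mono p = Σ-mono 1 r λ w w₁ w₂ → Σ-mono 1 r λ i i₁ i₂ → Σ-mono 0 (w ⊓ i) λ j j₁ j₂ →
    Σ-mono (lower w i j) ((w ⊓ i) ∸ j) λ k k₁ k₂ → p w i j k (inBox w₁ w₂ i₁ i₂ j₂ k₁ k₂)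

  box-member : ∀ f w i j k → InBox w i j k → f w i j k ≤ box f
  box-member f w i j k (inBox w₁ w₂ i₁ i₂ j₂ k₁ k₂) =
    ≤-trans (Σ-member (lower w i j) ((w ⊓ i) ∸ j) (f w i j) k k₁ k₂)
    (≤-trans (Σ-member 0 (w ⊓ i) (λ j → box₁ w i j (f w i j)) j z≤n j₂)
    (≤-trans (Σ-member 1 r (λ i → box₂ w i (f w i)) i i₁ i₂)
    (Σ-member 1 r (λ w → box₃ w (f w)) w w₁ w₂)))

  ∑-box : ∀ {A : Set} (L : List A) (f : A → ℕ → ℕ → ℕ → ℕ → ℕ) →
    ∑ L (λ x → box (f x)) ≡ box (λ w i j k → ∑ L (λ x → f x w i j k))
  ∑-box L f =
    trans (∑-Σ L 1 r (λ x w → box₃ w (f x w))) (Σ-cong 1 r λ w →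
    trans (∑-Σ L 1 r (λ x i → box₂ w i (f x w i))) (Σ-cong 1 r λ i →
    trans (∑-Σ L 0 (w ⊓ i) (λ x j → box₁ w i j (f x w i j))) (Σ-cong 0 (w ⊓ i) λ j →
    ∑-Σ L (lower w i j) ((w ⊓ i) ∸ j) (λ x → f x w i j))))

  InBox⇒w+i≤n+c : ∀ {w i j k} → InBox w i j k → w + i ≤ n + (j + k)
  InBox⇒w+i≤n+c {w} {i} {j} {k} b = begin
    w + i                                          ≤⟨ m≤n+m∸n (w + i) (j + ((r + j) ⊓ n)) ⟩
    j + ((r + j) ⊓ n) + lower w i j                ≤⟨ +-mono-≤ (+-monoʳ-≤ j (m⊓n≤n (r + j) n)) (InBox.b≤k b) ⟩
    j + n + k                                      ≡⟨ lem j n k ⟩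
    n + (j + k)                                    ∎
    where open ≤-Reasoning
          lem : ∀ j n k → j + n + k ≡ n + (j + k)
          lem = solve-∀

  InBox⇒c≤a : ∀ {w i j k} → InBox w i j k → j + k ≤ w ⊓ i
  InBox⇒c≤a {w} {i} {j} {k} b = ≤-trans (+-monoʳ-≤ j (InBox.k≤a∸j b)) (≤-reflexive (m+[n∸m]≡n (InBox.j≤a b)))

  boxProfile : ℕ → ℕ → ℕ → ℕ → Profile
  boxProfile w i j k = ⟨ j , k , w ∸ (j + k) , i ∸ (j + k) , (n + (j + k)) ∸ (w + i) ⟩

module _ (p n r : ℕ) where

  open Box n r

  count≤eSum : box (λ w i j k → Count.count (suc p) (suc p * p) (suc p) (suc p) n (boxProfile w i j k)) ≤ eSum (2 + p) n r
  count≤eSum = box-mono λ w i j k b → ≤-reflexive (go w i j k b)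
    where
    open ≡-Reasoning
    go : ∀ w i j k → InBox w i j k → let c = j + k in
      Count.count (suc p) (suc p * p) (suc p) (suc p) n (boxProfile w i j k)
      ≡ multinom n j k (w ∸ c) (i ∸ c) ((n + c) ∸ (w + i)) * p ^ k * suc p ^ ((w + i) ∸ c)
    go w i j k b = trans (count≡term p n j k (w ∸ c) (i ∸ c) ((n + c) ∸ (w + i)) total)
      (cong (λ t → multinom n j k (w ∸ c) (i ∸ c) ((n + c) ∸ (w + i)) * p ^ k * suc p ^ t) exponent)
      where
      c = j + k
      c≤a = InBox⇒c≤a b
      w≡ = m+[n∸m]≡n (≤-trans c≤a (m⊓n≤m w i))
      i≡ = m+[n∸m]≡n (≤-trans c≤a (m⊓n≤n w i))
      exponent : c + (w ∸ c + (i ∸ c)) ≡ (w + i) ∸ c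
      exponent = begin
        c + (w ∸ c + (i ∸ c))            ≡⟨ m+n∸m≡n c _ ⟨
        c + (c + (w ∸ c + (i ∸ c))) ∸ c  ≡⟨ cong (_∸ c) (lem c (w ∸ c) (i ∸ c)) ⟩
        (c + (w ∸ c)) + (c + (i ∸ c)) ∸ c ≡⟨ cong (_∸ c) (cong₂ _+_ w≡ i≡) ⟩
        (w + i) ∸ c                      ∎
        where lem : ∀ c x y → c + (c + (x + y)) ≡ (c + x) + (c + y)
              lem = solve-∀
      total : c + (w ∸ c + (i ∸ c + ((n + c) ∸ (w + i)))) ≡ n
      total = +-cancelʳ-≡ c _ _ (begin
        c + (w ∸ c + (i ∸ c + ((n + c) ∸ (w + i)))) + c
          ≡⟨ lem c (w ∸ c) (i ∸ c) _ ⟩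
        (c + (w ∸ c)) + (c + (i ∸ c)) + ((n + c) ∸ (w + i))
          ≡⟨ cong (_+ ((n + c) ∸ (w + i))) (cong₂ _+_ w≡ i≡) ⟩
        (w + i) + ((n + c) ∸ (w + i))
          ≡⟨ m+[n∸m]≡n (InBox⇒w+i≤n+c b) ⟩
        n + c ∎)
        where lem : ∀ c x y z → c + (x + (y + z)) + c ≡ (c + x) + (c + y) + z
              lem = solve-∀

  -- The cell is that of the pair's own profile, with w and i its distances from `v`. One cell for
  -- each pair bounds the number of pairs by the total over all cells.
  pair-in-box : ∀ (v x y : Vec (Fin (2 + p)) n) →
    1 ≤ hamming v x → hamming v x ≤ r → 1 ≤ hamming v y → hamming v y ≤ r → hamming x y ≤ r →
    1 ≤ box (λ w i j k → 𝟙 (matches (boxProfile w i j k) (profile v x y)))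
  pair-in-box v x y 1≤w w≤r 1≤i i≤r d≤r with profile v x y in eq | profile-hamming v x y | profile-total v x y
  ... | P@(⟨ j , k , xo , yo , o ⟩) | w≡ , i≡ , d≡ | total rewrite w≡ | i≡ | d≡ =
    ≤-trans (≤-reflexive (sym (trans (cong (λ Q → 𝟙 (matches Q P)) same-profile) (cong 𝟙 (matches-refl P)))))
            (box-member (λ w i j k → 𝟙 (matches (boxProfile w i j k) P)) (xo + (j + k)) (yo + (j + k)) j k
              (inBox 1≤w w≤r 1≤i i≤r (≤-trans (m≤m+n j k) c≤a) b≤k (m+n≤o⇒m≤o∸n k (subst (_≤ a) (+-comm j k) c≤a))))
    where
    a = (xo + (j + k)) ⊓ (yo + (j + k))
    c≤a : j + k ≤ a
    c≤a = ⊓-glb (m≤n+m (j + k) xo) (m≤n+m (j + k) yo)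
    same-profile : boxProfile (xo + (j + k)) (yo + (j + k)) j k ≡ P
    same-profile rewrite m+n∸n≡m xo (j + k) | m+n∸n≡m yo (j + k) = cong (λ o → ⟨ j , k , xo , yo , o ⟩) (begin
      n + (j + k) ∸ (xo + (j + k) + (yo + (j + k)))
        ≡⟨ cong (λ n → n + (j + k) ∸ (xo + (j + k) + (yo + (j + k)))) total ⟨
      j + k + (xo + (yo + o)) + (j + k) ∸ (xo + (j + k) + (yo + (j + k)))
        ≡⟨ cong (_∸ (xo + (j + k) + (yo + (j + k)))) (lem (j + k) xo yo o) ⟩
      o + (xo + (j + k) + (yo + (j + k))) ∸ (xo + (j + k) + (yo + (j + k)))
        ≡⟨ m+n∸n≡m o (xo + (j + k) + (yo + (j + k))) ⟩
      o ∎)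
      where open ≡-Reasoning
            lem : ∀ c x y o → c + (x + (y + o)) + c ≡ o + (x + c + (y + c))
            lem = solve-∀
    b≤k : lower (xo + (j + k)) (yo + (j + k)) j ≤ k
    b≤k = m≤n+o⇒m∸n≤o _ (j + ((r + j) ⊓ n)) (begin
      xo + (j + k) + (yo + (j + k))     ≡⟨ lem j k xo yo ⟩
      j + (xo + yo + k + j) + k         ≤⟨ +-monoˡ-≤ k (+-monoʳ-≤ j (⊓-glb (+-monoˡ-≤ j d≤r) ≤n)) ⟩
      j + ((r + j) ⊓ n) + k             ∎)
      where open ≤-Reasoning
            lem : ∀ j k x y → x + (j + k) + (y + (j + k)) ≡ j + (x + y + k + j) + k
            lem = solve-∀
            lem₂ : ∀ j k x y o → x + y + k + j + o ≡ j + k + (x + (y + o))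
            lem₂ = solve-∀
            ≤n : xo + yo + k + j ≤ n
            ≤n = ≤-trans (m≤m+n _ o) (≤-reflexive (trans (lem₂ j k xo yo o) total))

  punctured : Vec (Fin (2 + p)) n → Vec (Fin (2 + p)) n → Bool
  punctured v x = not (near 0 v x) ∧ near r v x

  adjacent-pairs≤eSum : ∀ (v : Vec (Fin (2 + p)) n) →
    ∑∑ (words (2 + p) n) (λ x y → 𝟙 (punctured v x ∧ (punctured v y ∧ near r x y))) ≤ eSum (2 + p) n r
  adjacent-pairs≤eSum v = begin
    ∑∑ U (λ x y → 𝟙 (punctured v x ∧ (punctured v y ∧ near r x y)))
      ≤⟨ ∑-mono U (λ x → ∑-mono U (λ y → pointwise x y)) ⟩
    ∑∑ U (λ x y → box (λ w i j k → 𝟙 (matches (boxProfile w i j k) (profile v x y))))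
      ≡⟨ ∑-cong U (λ x → ∑-box U (λ y w i j k → 𝟙 (matches (boxProfile w i j k) (profile v x y)))) ⟩
    ∑ U (λ x → box (λ w i j k → ∑ U (λ y → 𝟙 (matches (boxProfile w i j k) (profile v x y)))))
      ≡⟨ ∑-box U (λ x w i j k → ∑ U (λ y → 𝟙 (matches (boxProfile w i j k) (profile v x y)))) ⟩
    box (λ w i j k → ∑∑ U (λ x y → 𝟙 (matches (boxProfile w i j k) (profile v x y))))
      ≤⟨ box-mono (λ w i j k _ → ≤-reflexive (profile-count p n v (boxProfile w i j k))) ⟩
    box (λ w i j k → Count.count (suc p) (suc p * p) (suc p) (suc p) n (boxProfile w i j k))
      ≤⟨ count≤eSum ⟩
    eSum (2 + p) n r ∎
    where
    open ≤-Reasoning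
    U = words (2 + p) n
    pointwise : ∀ x y → 𝟙 (punctured v x ∧ (punctured v y ∧ near r x y)) ≤
      box (λ w i j k → 𝟙 (matches (boxProfile w i j k) (profile v x y)))
    pointwise x y with hamming v x in e₁ | near r v x in e₂ | hamming v y in e₃ | near r v y in e₄ | near r x y in e₅
    ... | zero  | _     | _     | _     | _     = z≤n
    ... | suc _ | false | _     | _     | _     = z≤n
    ... | suc _ | true  | zero  | _     | _     = z≤n
    ... | suc _ | true  | suc _ | false | _     = z≤n
    ... | suc _ | true  | suc _ | true  | false = z≤n
    ... | suc w | true  | suc i | true  | true  = pair-in-box v x y
      (subst (1 ≤_) (sym e₁) z<s) (subst (_≤ r) (sym e₁) (≤ᵇ⇒≤ (suc w) r (subst T (sym e₂) _)))
      (subst (1 ≤_) (sym e₃) z<s) (subst (_≤ r) (sym e₃) (≤ᵇ⇒≤ (suc i) r (subst T (sym e₄) _)))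
      (≤ᵇ⇒≤ (hamming x y) r (subst T (sym e₅) _))

-- Codes from the hard-core model

module _ {A : Set} (a : A → A → Bool) (a-sym : ∀ x y → a x y ≡ a y x) (a-refl : ∀ x → a x x ≡ true) where

  conflict-free? : ∀ x C → All (λ y → a x y ≡ false) C ⊎ 1 ≤ ∑ C (λ y → 𝟙 (a x y))
  conflict-free? x []      = inj₁ []
  conflict-free? x (y ∷ C) with a x y in eq
  ... | true  = inj₂ (s≤s z≤n)
  ... | false with conflict-free? x C
  ...   | inj₁ f = inj₁ (eq ∷ f)
  ...   | inj₂ p = inj₂ p

  -- Greedy choice from the end of the list: a word without conflict joins and covers itself, any
  -- other is already covered. Covering is stated as a sum so that exchanging the summations gives
  -- the Gilbert-Varshamov bound.
  maximal-code : ∀ L → ∃[ C ] (AllPairs (λ x y → a x y ≡ false) C × length L ≤ ∑ L (λ x → ∑ C (λ y → 𝟙 (a x y))))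
  maximal-code []      = [] , [] , z≤n
  maximal-code (x ∷ L) with maximal-code L
  ... | C , free , covered with conflict-free? x C
  ...   | inj₂ p = C , free , +-mono-≤ p covered
  ...   | inj₁ f = x ∷ C , f ∷ free , +-mono-≤
          (≤-trans (≤-reflexive (cong 𝟙 (sym (a-refl x)))) (m≤m+n _ _))
          (≤-trans covered (∑-mono L (λ z → m≤n+m _ (𝟙 (a z x)))))

module _ (p n r : ℕ) where

  private
    q = 2 + p
    U = words q n
    D = V q n r

  Spread : List (Vec (Fin q) n) → Set
  Spread = AllPairs (λ x y → near r x y ≡ false)

  ball-size′ : ∀ t x → ∑ U (λ v → 𝟙 (near t v x)) ≡ V q n t
  ball-size′ t x = trans (∑-cong U (λ v → cong 𝟙 (near-sym t v x))) (ball-size (suc p) n t x)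

  gilbert-varshamov : ∃[ C ] (Spread C × q ^ n ≤ D * length C)
  gilbert-varshamov with maximal-code (near r) (near-sym r) (near-refl r) U
  ... | C , free , covered = C , free , (begin
    q ^ n                                    ≡⟨ length-words q n ⟨
    length U                                 ≤⟨ covered ⟩
    ∑ U (λ x → ∑ C (λ y → 𝟙 (near r x y)))   ≡⟨ ∑-swap U C (λ x y → 𝟙 (near r x y)) ⟩
    ∑ C (λ y → ∑ U (λ x → 𝟙 (near r x y)))   ≡⟨ ∑-cong C (ball-size′ r) ⟩
    ∑ C (λ _ → D)                            ≡⟨ ∑-const D C ⟩
    D * length C                             ∎)
    where open ≤-Reasoning

  module Neighbourhood (v : Vec (Fin q) n) where

    others sphere far : List (Vec (Fin q) n)
    others = filterᵇ (not ∘ near 0 v) U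
    sphere = filterᵇ (near r v) others
    far    = filterᵇ (not ∘ near r v) others

    centre : filterᵇ (near 0 v) U ≡ v ∷ []
    -- The third abstraction excludes all shapes but a singleton, because a ball of radius 0 has
    -- size 1.
    centre with filterᵇ (near 0 v) U | all-filter (near 0 v) U | trans (length-filter (near 0 v) U) (ball-size (suc p) n 0 v)
    ... | x ∷ [] | e ∷ [] | _ = cong (_∷ []) (sym (near-0 v x e))

    words↭v∷others : U ↭ v ∷ others
    words↭v∷others = subst (λ L → U ↭ L ++ others) centre (filter-split (near 0 v) U)

    words↭ : U ↭ far ++ v ∷ sphere
    words↭ = ↭.trans words↭v∷others (↭.trans (↭.prep v (↭.trans (filter-split (near r v) others) (++-comm sphere far)))
      (↭-sym (shift v far sphere)))

    length-sphere : suc (length sphere) ≡ D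
    length-sphere = begin
      suc (length sphere)                              ≡⟨ cong suc (length-filter (near r v) others) ⟩
      1 + ∑ others (λ x → 𝟙 (near r v x))              ≡⟨ cong (λ b → 𝟙 b + ∑ others (λ x → 𝟙 (near r v x))) (near-refl r v) ⟨
      ∑ (v ∷ others) (λ x → 𝟙 (near r v x))            ≡⟨ ∑-↭ (λ x → 𝟙 (near r v x)) words↭v∷others ⟨
      ∑ U (λ x → 𝟙 (near r v x))                       ≡⟨ ball-size (suc p) n r v ⟩
      D                                                ∎
      where open ≡-Reasoning

    ∑-sphere : ∀ f → ∑ sphere f ≡ ∑ U (λ x → 𝟙 (punctured p n r v x) * f x)
    ∑-sphere f = begin
      ∑ sphere f
        ≡⟨ ∑-filter (near r v) others f ⟩
      ∑ others (λ x → 𝟙 (near r v x) * f x)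
        ≡⟨ ∑-filter (not ∘ near 0 v) U _ ⟩
      ∑ U (λ x → 𝟙 (not (near 0 v x)) * (𝟙 (near r v x) * f x))
        ≡⟨ ∑-cong U (λ x → lem (not (near 0 v x)) (near r v x) (f x)) ⟩
      ∑ U (λ x → 𝟙 (punctured p n r v x) * f x) ∎
      where open ≡-Reasoning
            lem : ∀ b c k → 𝟙 b * (𝟙 c * k) ≡ 𝟙 (b ∧ c) * k
            lem true  c k = +-identityʳ _
            lem false c k = refl

    sphere-pairs≤eSum : ∑∑ sphere (λ x y → 𝟙 (near r x y)) ≤ eSum q n r
    sphere-pairs≤eSum = ≤-trans (≤-reflexive (begin
      ∑∑ sphere (λ x y → 𝟙 (near r x y))
        ≡⟨ ∑-sphere _ ⟩
      ∑ U (λ x → 𝟙 (P x) * ∑ sphere (λ y → 𝟙 (near r x y)))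
        ≡⟨ ∑-cong U (λ x → cong (𝟙 (P x) *_) (∑-sphere (λ y → 𝟙 (near r x y)))) ⟩
      ∑ U (λ x → 𝟙 (P x) * ∑ U (λ y → 𝟙 (P y) * 𝟙 (near r x y)))
        ≡⟨ ∑-cong U (λ x → ∑-* (𝟙 (P x)) U _) ⟨
      ∑∑ U (λ x y → 𝟙 (P x) * (𝟙 (P y) * 𝟙 (near r x y)))
        ≡⟨ ∑-cong U (λ x → ∑-cong U (λ y → lem (P x) (P y) (near r x y))) ⟩
      ∑∑ U (λ x y → 𝟙 (P x ∧ (P y ∧ near r x y))) ∎))
      (adjacent-pairs≤eSum p n r v)
      where open ≡-Reasoning
            P = punctured p n r v
            lem : ∀ b c d → 𝟙 b * (𝟙 c * 𝟙 d) ≡ 𝟙 (b ∧ (c ∧ d))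
            lem false c     d     = refl
            lem true  false d     = refl
            lem true  true  false = refl
            lem true  true  true  = refl

  module _ (m : ℕ) .{{_ : NonZero m}} (s : ℕ) (s≤D : s * (1 + m * 2 ^ (2 + s)) ≤ D)
           (P≤m² : eSum q n r ∸ (D ∸ 1) ≤ m * m) where

    open HardCore (near {q} {n} r) (near-sym r) m

    private
      all : Vec (Fin q) n → Bool
      all _ = true

    score : Vec (Fin q) n → Vec (Fin q) n → ℕ
    score v x = D * 𝟙 (near 0 v x) + 2 * 𝟙 (near r v x)

    total-score : ∀ x → ∑ U (λ v → score v x) ≡ 3 * D
    total-score x = begin
      ∑ U (λ v → score v x)
        ≡⟨ ∑-+ U (λ v → D * 𝟙 (near 0 v x)) (λ v → 2 * 𝟙 (near r v x)) ⟩
      ∑ U (λ v → D * 𝟙 (near 0 v x)) + ∑ U (λ v → 2 * 𝟙 (near r v x))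
        ≡⟨ cong₂ _+_ (∑-* D U (λ v → 𝟙 (near 0 v x))) (∑-* 2 U (λ v → 𝟙 (near r v x))) ⟩
      D * ∑ U (λ v → 𝟙 (near 0 v x)) + 2 * ∑ U (λ v → 𝟙 (near r v x))
        ≡⟨ cong₂ (λ b c → D * b + 2 * c) (ball-size′ 0 x) (ball-size′ r x) ⟩
      D * 1 + 2 * D
        ≡⟨ cong (_+ 2 * D) (*-identityʳ D) ⟩
      3 * D ∎
      where open ≡-Reasoning

    mean-score : ∀ v → s * Z all U ≤ W (score v) 0 all U
    mean-score v rewrite W-↭ (λ _ → 0) (Neighbourhood.words↭ v) 1 all
                       | W-↭ (score v) (Neighbourhood.words↭ v) 0 all =
      local-mean (near r) (near-sym r) m s D (score v) v far sphere s≤D sparse D≤score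
        (All.map 2≤score (all-filter (near r v) others)) (all-filter (near r v) others)
        (All.map not-true (all-filter (not ∘ near r v) others)) all refl
      where
      open Neighbourhood v
      D≤score : D ≤ score v v
      D≤score rewrite near-refl 0 v = ≤-trans (≤-reflexive (sym (*-identityʳ D))) (m≤m+n _ _)
      2≤score : ∀ {x} → near r v x ≡ true → 2 ≤ score v x
      2≤score {x} e rewrite e = m≤n+m 2 _
      not-true : ∀ {x} → not (near r v x) ≡ true → near r v x ≡ false
      not-true {x} e with near r v x
      ... | false = refl
      sparse : activePairs all sphere ≤ m * m
      sparse = ≤-trans (m+n≤o⇒m≤o∸n (activePairs all sphere)
        (subst (λ k → activePairs all sphere + k ≤ eSum q n r) (cong (_∸ 1) length-sphere)
          (≤-trans (activePairs≤∑ (near-refl r) all sphere) sphere-pairs≤eSum))) P≤m²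

    Z-positive : ∀ c L → 0 < Z c L
    Z-positive c []      = z<s
    Z-positive c (x ∷ L) = <-≤-trans (*-mono-< (>-nonZero⁻¹ m) (Z-positive c L)) (m≤m+n _ _)

    hard-core-code : ∃[ C ] (Spread C × q ^ n * s ≤ 3 * D * length C)
    hard-core-code with find (q ^ n * s) (λ _ → 3 * D) 0 all U
    ... | inj₁ (C , (free , _) , large) = C , free , subst (q ^ n * s ≤_) (∑-const (3 * D) C) large
    ... | inj₂ small = contradiction (begin-strict
      q ^ n * s * Z all U               ≡⟨ *-assoc (q ^ n) s _ ⟩
      q ^ n * (s * Z all U)             ≡⟨ cong (_* (s * Z all U)) (length-words q n) ⟨
      length U * (s * Z all U)          ≡⟨ *-comm (length U) _ ⟩
      s * Z all U * length U            ≡⟨ ∑-const (s * Z all U) U ⟨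
      ∑ U (λ _ → s * Z all U)           ≤⟨ ∑-mono U mean-score ⟩
      ∑ U (λ v → W (score v) 0 all U)   ≡⟨ W-∑ U score all U ⟩
      W (λ x → ∑ U (λ v → score v x)) 0 all U
        ≤⟨ W-mono U (All.universal (λ x → ≤-reflexive (total-score x)) U) ≤-refl (λ _ → id) ⟩
      -- The `suc α` in `find` provides this additional `Z all U`; its positivity makes the chain
      -- strict.
      W (λ _ → 3 * D) 0 all U           <⟨ m<n+m _ (Z-positive all U) ⟩
      Z all U + W (λ _ → 3 * D) 0 all U ≡⟨ W-suc (λ _ → 3 * D) 0 all U ⟨
      W (λ _ → 3 * D) 1 all U           ≤⟨ small ⟩
      q ^ n * s * Z all U               ∎) (n≮n _)
      where open ≤-Reasoning

-- Choice of the parameters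

n<2^n : ∀ n → n < 2 ^ n
n<2^n zero    = z<s
n<2^n (suc n) = begin-strict
  suc n            ≤⟨ n<2^n n ⟩
  2 ^ n            <⟨ m<m+n (2 ^ n) (≤-<-trans z≤n (n<2^n n)) ⟩
  2 ^ n + 2 ^ n    ≡⟨ cong (2 ^ n +_) (+-identityʳ (2 ^ n)) ⟨
  2 * 2 ^ n        ∎
  where open ≤-Reasoning

-- The witness `suc k` is the square root of `suc P` rounded up. When it grows to m, the argument is
-- at least 1 + (m - 1)², and m² + (m - 2)² = 2 (1 + (m - 1)²).
√-between : ∀ P → ∃[ k ] (suc P ≤ suc k * suc k × suc k * suc k ≤ 2 * suc P)
√-between zero    = 0 , ≤-refl , s≤s z≤n
√-between (suc P) with √-between P
... | k , lo , hi with suc (suc P) ≤? suc k * suc k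
...   | yes p = k , p , ≤-trans hi (*-monoʳ-≤ 2 (n≤1+n (suc P)))
...   | no  p = suc k , ≤-trans (s≤s lo) (≤-trans (m≤m+n _ (2 + 2 * k)) (≤-reflexive (lem₁ k))) ,
        ≤-trans (m≤m+n _ (k * k)) (≤-trans (≤-reflexive (lem₂ k)) (*-monoʳ-≤ 2 (≰⇒> p)))
  where
  lem₁ : ∀ k → 1 + (1 + k) * (1 + k) + (2 + 2 * k) ≡ (2 + k) * (2 + k)
  lem₁ = solve-∀
  lem₂ : ∀ k → (2 + k) * (2 + k) + k * k ≡ 2 * (1 + (1 + k) * (1 + k))
  lem₂ = solve-∀

-- Scanning down from `b + a`, either `Q` persists as far as `a` or its first failure is the `s` of
-- a crossing.
leastAbove : ∀ {Q : ℕ → Set} → (∀ s → Dec (Q s)) → ∀ a b → Q (b + a) → Q a ⊎ ∃[ s ] (a ≤ s × ¬ Q s × Q (suc s))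
leastAbove Q? a zero    q = inj₁ q
leastAbove Q? a (suc b) q with Q? (b + a)
... | yes q′ = leastAbove Q? a b q′
... | no  ¬q = inj₂ (b + a , m≤n+m a b , ¬q , q)

-- Since m ≥ 1, `m * threshold s` dominates the degree condition `s * (1 + m * 2 ^ (2 + s))`, with m
-- split off as a factor.
threshold : ℕ → ℕ
threshold s = s * (1 + 2 ^ (2 + s))

threshold-suc : ∀ s → threshold (2 + s) ≤ 4 * threshold (1 + s)
threshold-suc s = ≤-trans (*-mono-≤ (m≤m+n (2 + s) s) (+-monoˡ-≤ (2 ^ (4 + s)) (s≤s (z≤n {1}))))
  (≤-reflexive (lem s (2 ^ (2 + suc s))))
  where lem : ∀ s t → (2 + s + s) * (2 + 2 * t) ≡ 4 * ((1 + s) * (1 + t))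
        lem = solve-∀

sixth-power-step : ∀ a b b′ E F → b′ ≤ 4 * b → 4 ^ 6 ≤ F → a * b ^ 6 ≤ E → a * b′ ^ 6 ≤ F * E
sixth-power-step a b b′ E F b′≤4b 4^6≤F ab^6≤E = begin
  a * b′ ^ 6           ≤⟨ *-monoʳ-≤ a (^-monoˡ-≤ 6 b′≤4b) ⟩
  a * (4 * b) ^ 6      ≡⟨ cong (a *_) (^-distribʳ-* 4 b 6) ⟩
  a * (4 ^ 6 * b ^ 6)  ≡⟨ lem a (4 ^ 6) (b ^ 6) ⟩
  4 ^ 6 * (a * b ^ 6)  ≤⟨ *-mono-≤ 4^6≤F ab^6≤E ⟩
  F * E                ∎
  where open ≤-Reasoning
        lem : ∀ a b c → a * (b * c) ≡ b * (a * c)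
        lem = solve-∀

threshold-induction : ∀ a c → 4 ^ 6 ≤ 2 ^ c → a * threshold 4 ^ 6 ≤ 2 ^ (c * 3) →
  ∀ t → a * threshold (4 + t) ^ 6 ≤ 2 ^ (c * (3 + t))
threshold-induction a c step base zero    = base
threshold-induction a c step base (suc t) = subst (a * threshold (5 + t) ^ 6 ≤_)
  (trans (sym (^-distribˡ-+-* 2 c (c * (3 + t)))) (cong (2 ^_) (sym (*-suc c (3 + t)))))
  (sixth-power-step a (threshold (4 + t)) (threshold (5 + t)) (2 ^ (c * (3 + t))) (2 ^ c)
    (threshold-suc (3 + t)) step (threshold-induction a c step base t))

-- The base case is 1728 · 260 ^ 6 ≤ 2 ^ 60; each step multiplies the left by at most 4 ^ 6 = 2 ^ 12
-- and the right by 2 ^ 20. The factor 1728 = 12³ comes from `large-degree`.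
threshold-bound : ∀ t → 1728 * threshold (4 + t) ^ 6 ≤ 2 ^ (20 * (3 + t))
threshold-bound = threshold-induction 1728 20 (≤ᵇ⇒≤ (4 ^ 6) (2 ^ 20) _) (≤ᵇ⇒≤ (1728 * threshold 4 ^ 6) (2 ^ 60) _)

-- With e = P / 6 this reads (3/20) log₂ (D² / e) ≤ s; the cube clears the denominator of 20 s / 3.
record Bounded (D P s : ℕ) : Set where
  constructor bounded
  field bound : (6 * (D * D)) ^ 3 ≤ 2 ^ (20 * s) * P ^ 3

bounded? : ∀ D P s → Dec (Bounded D P s)
bounded? D P s = map′ bounded Bounded.bound ((6 * (D * D)) ^ 3 ≤? 2 ^ (20 * s) * P ^ 3)

-- A crude starting point for the search, from X < 2 ^ X.
eventually-bounded : ∀ D P .{{_ : NonZero P}} s → Bounded D P ((6 * (D * D)) ^ 3 + s)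
eventually-bounded D P s = bounded (begin
  X                          ≤⟨ <⇒≤ (n<2^n X) ⟩
  2 ^ X                      ≤⟨ ^-monoʳ-≤ 2 (≤-trans (m≤m+n X s) (m≤n*m (X + s) 20)) ⟩
  2 ^ (20 * (X + s))         ≤⟨ m≤m*n _ (P ^ 3) {{m^n≢0 P 3}} ⟩
  2 ^ (20 * (X + s)) * P ^ 3 ∎)
  where
  open ≤-Reasoning
  X = (6 * (D * D)) ^ 3

-- Otherwise D ≤ m B with `B = threshold (suc s)`, so 6 D² ≤ 6 m² B² ≤ 12 P B², whose cube 1728 B⁶
-- P³ is at most 2 ^ (20 s) P³. Here m² ≤ 2 P enters.
large-degree : ∀ m s D P .{{_ : NonZero m}} → 3 ≤ s → m * m ≤ 2 * P → ¬ Bounded D P s →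
  suc s * (1 + m * 2 ^ (2 + suc s)) ≤ D
large-degree m s D P 3≤s m²≤2P ¬small = ≮⇒≥ λ D< → contradiction (begin
  (6 * (D * D)) ^ 3
    ≤⟨ ^-monoˡ-≤ 3 (*-monoʳ-≤ 6 (*-mono-≤ (D≤mB D<) (D≤mB D<))) ⟩
  (6 * (m * B * (m * B))) ^ 3
    ≡⟨ cong (_^ 3) (lem₁ m B) ⟩
  (6 * (m * m) * (B * B)) ^ 3
    ≤⟨ ^-monoˡ-≤ 3 (*-monoˡ-≤ (B * B) (*-monoʳ-≤ 6 m²≤2P)) ⟩
  (6 * (2 * P) * (B * B)) ^ 3
    ≡⟨ lem₂ P B ⟩
  1728 * B ^ 6 * P ^ 3
    ≤⟨ *-monoˡ-≤ (P ^ 3) bound ⟩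
  2 ^ (20 * s) * P ^ 3 ∎) (¬small ∘ bounded)
  where
  open ≤-Reasoning
  B = threshold (suc s)
  D≤mB : D < suc s * (1 + m * 2 ^ (2 + suc s)) → D ≤ m * B
  D≤mB l = begin
    D                                   ≤⟨ <⇒≤ l ⟩
    suc s * (1 + m * 2 ^ (2 + suc s))       ≤⟨ *-monoʳ-≤ (suc s) (+-monoˡ-≤ _ (>-nonZero⁻¹ m)) ⟩
    suc s * (m + m * 2 ^ (2 + suc s))       ≡⟨ lem (suc s) m (2 ^ (2 + suc s)) ⟩
    m * B                               ∎
    where lem : ∀ s m t → s * (m + m * t) ≡ m * (s * (1 + t))
          lem = solve-∀
  bound : 1728 * B ^ 6 ≤ 2 ^ (20 * s)
  bound = subst (λ s → 1728 * threshold (suc s) ^ 6 ≤ 2 ^ (20 * s)) {3 + (s ∸ 3)} {s} (m+[n∸m]≡n {3} {s} 3≤s) (threshold-bound (s ∸ 3))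
  lem₁ : ∀ m b → 6 * (m * b * (m * b)) ≡ 6 * (m * m) * (b * b)
  lem₁ = solve-∀
  lem₂ : ∀ p b → (6 * (2 * p) * (b * b)) ^ 3 ≡ 1728 * b ^ 6 * p ^ 3
  lem₂ p b = begin-equality
    (6 * (2 * p) * (b * b)) ^ 3      ≡⟨ cong (_^ 3) (lem p (b * b)) ⟩
    (12 * (b * b) * p) ^ 3           ≡⟨ ^-distribʳ-* (12 * (b * b)) p 3 ⟩
    (12 * (b * b)) ^ 3 * p ^ 3       ≡⟨ cong (_* p ^ 3) (^-distribʳ-* 12 (b * b) 3) ⟩
    12 ^ 3 * (b * b) ^ 3 * p ^ 3     ≡⟨ cong (λ c → 12 ^ 3 * c * p ^ 3) (trans (^-distribʳ-* b b 3) (sym (^-distribˡ-+-* b 3 3))) ⟩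
    1728 * b ^ 6 * p ^ 3             ∎
    where lem : ∀ p c → 6 * (2 * p) * c ≡ 12 * c * p
          lem = solve-∀

-- After cubing, the N-th power of `Bounded` applies, and the 3 of `3 * D * c` is absorbed by the
-- cube.
exponential-bound : ∀ N s D P c → Bounded D P s → N * s ≤ 3 * D * c →
  (6 * (D * D)) ^ N ≤ 2 ^ (20 * c * D) * P ^ N
exponential-bound N s D P c (bounded small) large = ^-cancelˡ-≤ 3 (begin
  (X ^ N) ^ 3
    ≡⟨ ^-comm-exponents X N 3 ⟩
  (X ^ 3) ^ N
    ≤⟨ ^-monoˡ-≤ N small ⟩
  (2 ^ (20 * s) * P ^ 3) ^ N
    ≡⟨ ^-distribʳ-* (2 ^ (20 * s)) (P ^ 3) N ⟩
  (2 ^ (20 * s)) ^ N * (P ^ 3) ^ N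
    ≡⟨ cong₂ _*_ (^-*-assoc 2 (20 * s) N) (^-comm-exponents P 3 N) ⟩
  2 ^ (20 * s * N) * (P ^ N) ^ 3
    ≤⟨ *-monoˡ-≤ ((P ^ N) ^ 3) (^-monoʳ-≤ 2 exponents) ⟩
  2 ^ (20 * c * D * 3) * (P ^ N) ^ 3
    ≡⟨ cong (_* (P ^ N) ^ 3) (^-*-assoc 2 (20 * c * D) 3) ⟨
  (2 ^ (20 * c * D)) ^ 3 * (P ^ N) ^ 3
    ≡⟨ ^-distribʳ-* (2 ^ (20 * c * D)) (P ^ N) 3 ⟨
  (2 ^ (20 * c * D) * P ^ N) ^ 3 ∎)
  where
  open ≤-Reasoning
  X = 6 * (D * D)
  exponents : 20 * s * N ≤ 20 * c * D * 3
  exponents = begin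
    20 * s * N          ≡⟨ lem₁ s N ⟩
    20 * (N * s)        ≤⟨ *-monoʳ-≤ 20 large ⟩
    20 * (3 * D * c)    ≡⟨ lem₂ D c ⟩
    20 * c * D * 3      ∎
    where lem₁ : ∀ s N → 20 * s * N ≡ 20 * (N * s)
          lem₁ = solve-∀
          lem₂ : ∀ D c → 20 * (3 * D * c) ≡ 20 * c * D * 3
          lem₂ = solve-∀

bounded-or-least : ∀ D P .{{_ : NonZero P}} a →
  Bounded D P a ⊎ ∃[ s ] (a ≤ s × ¬ Bounded D P s × Bounded D P (suc s))
bounded-or-least D P a = leastAbove (bounded? D P) a ((6 * (D * D)) ^ 3) (eventually-bounded D P a)

-- The two regimes meet at 3: `N ≤ D * size C` is the sparse conclusion for s = 3, and 3 is also
-- where `threshold-bound` begins, its inequality being false one step earlier. Beyond 3, failure at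
-- `s` supplies the degree condition and success at `suc s` the final estimate.
optimise : ∀ {A : Set} (S : A → Set) (size : A → ℕ) N D P .{{_ : NonZero P}} →
  ∃[ C ] (S C × N ≤ D * size C) →
  (∀ m .{{_ : NonZero m}} s → s * (1 + m * 2 ^ (2 + s)) ≤ D → P ≤ m * m → ∃[ C ] (S C × N * s ≤ 3 * D * size C)) →
  ∃[ C ] (S C × (6 * (D * D)) ^ N ≤ 2 ^ (20 * size C * D) * P ^ N)
optimise S size N D P@(suc P-1) dense sparse with √-between P-1 | bounded-or-least D P 3
... | _ | inj₁ small = map₂ (λ {C} → map₂ (λ N≤ → exponential-bound N 3 D P (size C) small
        (≤-trans (*-monoˡ-≤ 3 N≤) (≤-reflexive (lem D (size C)))))) dense
  where lem : ∀ D c → D * c * 3 ≡ 3 * D * c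
        lem = solve-∀
... | k , P≤m² , m²≤2P | inj₂ (s , 3≤s , ¬small , small) =
        map₂ (λ {C} → map₂ (exponential-bound N (suc s) D P (size C) small))
          (sparse (suc k) (suc s) (large-degree (suc k) s D P 3≤s m²≤2P ¬small) P≤m²)

large-code : ∀ p n r → let q = 2 + p; D = V q n r; P = eSum q n r ∸ (D ∸ 1) in .{{_ : NonZero P}} →
  ∃[ C ] (Spread p n r C × (6 * (D * D)) ^ (q ^ n) ≤ 2 ^ (20 * length C * D) * P ^ (q ^ n))
large-code p n r = optimise (Spread p n r) length ((2 + p) ^ n) (V (2 + p) n r) (eSum (2 + p) n r ∸ (V (2 + p) n r ∸ 1))
  (gilbert-varshamov p n r) (λ m s → hard-core-code p n r m s)

-- Rational numbers

fromℚᵘ-mono-≤ : ∀ {x y} → x ℚᵘ.≤ y → ℚ.fromℚᵘ x ℚ.≤ ℚ.fromℚᵘ y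
fromℚᵘ-mono-≤ {x} {y} x≤y = ℚ.toℚᵘ-cancel-≤
  (ℚᵘ.≤-respˡ-≃ (ℚᵘ.≃-sym (ℚ.toℚᵘ-fromℚᵘ x)) (ℚᵘ.≤-respʳ-≃ (ℚᵘ.≃-sym (ℚ.toℚᵘ-fromℚᵘ y)) x≤y))

fromℚᵘ-homo-* : ∀ x y → ℚ.fromℚᵘ (x ℚᵘ.* y) ≡ ℚ.fromℚᵘ x ℚ.* ℚ.fromℚᵘ y
fromℚᵘ-homo-* x y = ℚ.toℚᵘ-injective (begin
  ℚ.toℚᵘ (ℚ.fromℚᵘ (x ℚᵘ.* y))                          ≈⟨ ℚ.toℚᵘ-fromℚᵘ (x ℚᵘ.* y) ⟩
  x ℚᵘ.* y                                              ≈⟨ ℚᵘ.*-cong (ℚ.toℚᵘ-fromℚᵘ x) (ℚ.toℚᵘ-fromℚᵘ y) ⟨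
  ℚ.toℚᵘ (ℚ.fromℚᵘ x) ℚᵘ.* ℚ.toℚᵘ (ℚ.fromℚᵘ y)           ≈⟨ ℚ.toℚᵘ-homo-* (ℚ.fromℚᵘ x) (ℚ.fromℚᵘ y) ⟨
  ℚ.toℚᵘ (ℚ.fromℚᵘ x ℚ.* ℚ.fromℚᵘ y)                    ∎)
  where open import Relation.Binary.Reasoning.Setoid ℚᵘ.≃-setoid

fromℚᵘ-homo-+ : ∀ x y → ℚ.fromℚᵘ (x ℚᵘ.+ y) ≡ ℚ.fromℚᵘ x ℚ.+ ℚ.fromℚᵘ y
fromℚᵘ-homo-+ x y = ℚ.toℚᵘ-injective (begin
  ℚ.toℚᵘ (ℚ.fromℚᵘ (x ℚᵘ.+ y))                          ≈⟨ ℚ.toℚᵘ-fromℚᵘ (x ℚᵘ.+ y) ⟩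
  x ℚᵘ.+ y                                              ≈⟨ ℚᵘ.+-cong (ℚ.toℚᵘ-fromℚᵘ x) (ℚ.toℚᵘ-fromℚᵘ y) ⟨
  ℚ.toℚᵘ (ℚ.fromℚᵘ x) ℚᵘ.+ ℚ.toℚᵘ (ℚ.fromℚᵘ y)           ≈⟨ ℚ.toℚᵘ-homo-+ (ℚ.fromℚᵘ x) (ℚ.fromℚᵘ y) ⟨
  ℚ.toℚᵘ (ℚ.fromℚᵘ x ℚ.+ ℚ.fromℚᵘ y)                    ∎)
  where open import Relation.Binary.Reasoning.Setoid ℚᵘ.≃-setoid

ℕ→ℚ-mono-≤ : ∀ {a b} → a ≤ b → ℕ→ℚ a ℚ.≤ ℕ→ℚ b
ℕ→ℚ-mono-≤ {a} {b} a≤b = fromℚᵘ-mono-≤ {mkℚᵘ (ℤ.+ a) 0} {mkℚᵘ (ℤ.+ b) 0} (ℚᵘ.*≤* (ℤ.*-monoʳ-≤-nonNeg (ℤ.+ 1) (ℤ.+≤+ a≤b)))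

ℕ→ℚ-* : ∀ a b → ℕ→ℚ (a * b) ≡ ℕ→ℚ a ℚ.* ℕ→ℚ b
ℕ→ℚ-* a b = trans (cong (λ z → z ℚ./ 1) (ℤ.pos-* a b)) (fromℚᵘ-homo-* (mkℚᵘ (ℤ.+ a) 0) (mkℚᵘ (ℤ.+ b) 0))

ℕ→ℚ-^ : ∀ a k → ℕ→ℚ (a ^ k) ≡ ℕ→ℚ a ^ℚ k
ℕ→ℚ-^ a zero    = refl
ℕ→ℚ-^ a (suc k) = trans (ℕ→ℚ-* a (a ^ k)) (cong (ℕ→ℚ a ℚ.*_) (ℕ→ℚ-^ a k))

^ℚ-distribʳ-* : ∀ x y k → (x ℚ.* y) ^ℚ k ≡ (x ^ℚ k) ℚ.* (y ^ℚ k)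
^ℚ-distribʳ-* x y zero    = refl
^ℚ-distribʳ-* x y (suc k) = trans (cong ((x ℚ.* y) ℚ.*_) (^ℚ-distribʳ-* x y k)) (interchange x y (x ^ℚ k) (y ^ℚ k))
  where open import Algebra.Properties.CommutativeSemigroup (CommutativeMonoid.commutativeSemigroup ℚ.*-1-commutativeMonoid) using (interchange)

sixths : ℕ → ℕ → ℚ
sixths x y = (ℤ.+ x ℚ./ 6) ℚ.- (ℤ.+ y ℚ./ 6)

6*sixths : ∀ a y → sixths (a + y) y ℚ.* ℕ→ℚ 6 ≡ ℕ→ℚ a
6*sixths a y = begin
  sixths (a + y) y ℚ.* ℕ→ℚ 6
    ≡⟨ cong (λ z → (z ℚ.- (ℤ.+ y ℚ./ 6)) ℚ.* ℕ→ℚ 6) (trans (ℚ.fromℚᵘ-cong {mkℚᵘ (ℤ.+ (a + y)) 5} {mkℚᵘ (ℤ.+ a) 5 ℚᵘ.+ mkℚᵘ (ℤ.+ y) 5} (ℚᵘ.*≡* (sum-sixths (ℤ.+ a) (ℤ.+ y)))) (fromℚᵘ-homo-+ (mkℚᵘ (ℤ.+ a) 5) (mkℚᵘ (ℤ.+ y) 5))) ⟩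
  (((ℤ.+ a ℚ./ 6) ℚ.+ (ℤ.+ y ℚ./ 6)) ℚ.- (ℤ.+ y ℚ./ 6)) ℚ.* ℕ→ℚ 6
    ≡⟨ cong (ℚ._* ℕ→ℚ 6) (trans (ℚ.+-assoc (ℤ.+ a ℚ./ 6) (ℤ.+ y ℚ./ 6) (ℚ.- (ℤ.+ y ℚ./ 6))) (trans (cong ((ℤ.+ a ℚ./ 6) ℚ.+_) (ℚ.+-inverseʳ (ℤ.+ y ℚ./ 6))) (ℚ.+-identityʳ (ℤ.+ a ℚ./ 6)))) ⟩
  (ℤ.+ a ℚ./ 6) ℚ.* ℕ→ℚ 6
    ≡⟨ fromℚᵘ-homo-* (mkℚᵘ (ℤ.+ a) 5) (mkℚᵘ (ℤ.+ 6) 0) ⟨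
  ℚ.fromℚᵘ (mkℚᵘ (ℤ.+ a) 5 ℚᵘ.* mkℚᵘ (ℤ.+ 6) 0)
    ≡⟨ ℚ.fromℚᵘ-cong {mkℚᵘ (ℤ.+ a) 5 ℚᵘ.* mkℚᵘ (ℤ.+ 6) 0} {mkℚᵘ (ℤ.+ a) 0} (ℚᵘ.*≡* (cancel (ℤ.+ a))) ⟩
  ℕ→ℚ a ∎
  where
  open ≡-Reasoning
  sum-sixths : ∀ a y → (a ℤ.+ y) ℤ.* ℤ.+ 36 ≡ (a ℤ.* ℤ.+ 6 ℤ.+ y ℤ.* ℤ.+ 6) ℤ.* ℤ.+ 6
  sum-sixths = ℤ-Solver.solve-∀
  cancel : ∀ a → a ℤ.* ℤ.+ 6 ℤ.* ℤ.+ 1 ≡ a ℤ.* ℤ.+ 6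
  cancel = ℤ-Solver.solve-∀

sixths≤0 : ∀ {x y} → x ≤ y → sixths x y ℚ.≤ 0ℚ
sixths≤0 {x} {y} x≤y = begin
  sixths x y                             ≤⟨ ℚ.+-monoˡ-≤ (ℚ.- (ℤ.+ y ℚ./ 6)) (fromℚᵘ-mono-≤ {mkℚᵘ (ℤ.+ x) 5} {mkℚᵘ (ℤ.+ y) 5}
                                              (ℚᵘ.*≤* (ℤ.*-monoʳ-≤-nonNeg (ℤ.+ 6) (ℤ.+≤+ x≤y)))) ⟩
  (ℤ.+ y ℚ./ 6) ℚ.- (ℤ.+ y ℚ./ 6)        ≡⟨ ℚ.+-inverseʳ (ℤ.+ y ℚ./ 6) ⟩
  0ℚ                                     ∎
  where open ℚ.≤-Reasoning

-- Positivity of `e` thereby makes P positive and its truncated subtraction exact.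
0<sixths⇒ : ∀ x y → 0ℚ ℚ.< sixths x y → y < x
0<sixths⇒ x y 0<e = ≰⇒> λ x≤y → ℚ.<-irrefl refl (ℚ.<-≤-trans 0<e (sixths≤0 x≤y))

-- Multiplying by 6 ^ N turns e ^ N into P ^ N, which reduces the claim to natural numbers.
rational-bound : ∀ D P K N e → e ℚ.* ℕ→ℚ 6 ≡ ℕ→ℚ P → (6 * (D * D)) ^ N ≤ K * P ^ N →
  ℕ→ℚ D ^ℚ (2 * N) ℚ.≤ ℕ→ℚ K ℚ.* (e ^ℚ N)
rational-bound D P K N e 6e≡P bound =
  ℚ.*-cancelʳ-≤-pos (ℕ→ℚ (6 ^ N)) {{ℚ.normalize-pos (6 ^ N) 1 {{_}} {{m^n≢0 6 N}}}} (begin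
    (ℕ→ℚ D ^ℚ (2 * N)) ℚ.* ℕ→ℚ (6 ^ N)
      ≡⟨ cong (ℚ._* ℕ→ℚ (6 ^ N)) (ℕ→ℚ-^ D (2 * N)) ⟨
    ℕ→ℚ (D ^ (2 * N)) ℚ.* ℕ→ℚ (6 ^ N)
      ≡⟨ ℕ→ℚ-* (D ^ (2 * N)) (6 ^ N) ⟨
    ℕ→ℚ (D ^ (2 * N) * 6 ^ N)
      ≤⟨ ℕ→ℚ-mono-≤ (subst (_≤ K * P ^ N) rearrange bound) ⟩
    ℕ→ℚ (K * P ^ N)
      ≡⟨ ℕ→ℚ-* K (P ^ N) ⟩
    ℕ→ℚ K ℚ.* ℕ→ℚ (P ^ N)
      ≡⟨ cong (ℕ→ℚ K ℚ.*_) power ⟩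
    ℕ→ℚ K ℚ.* ((e ^ℚ N) ℚ.* ℕ→ℚ (6 ^ N))
      ≡⟨ ℚ.*-assoc (ℕ→ℚ K) (e ^ℚ N) (ℕ→ℚ (6 ^ N)) ⟨
    ℕ→ℚ K ℚ.* (e ^ℚ N) ℚ.* ℕ→ℚ (6 ^ N) ∎)
  where
  open ℚ.≤-Reasoning
  rearrange : (6 * (D * D)) ^ N ≡ D ^ (2 * N) * 6 ^ N
  rearrange = trans (^-distribʳ-* 6 (D * D) N) (trans (*-comm (6 ^ N) _)
    (cong (_* 6 ^ N) (trans (cong (λ d → (D * d) ^ N) (sym (*-identityʳ D))) (^-*-assoc D 2 N))))
  power : ℕ→ℚ (P ^ N) ≡ (e ^ℚ N) ℚ.* ℕ→ℚ (6 ^ N)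
  power = trans (ℕ→ℚ-^ P N) (trans (cong (_^ℚ N) (sym 6e≡P))
    (trans (^ℚ-distribʳ-* e (ℕ→ℚ 6) N) (cong ((e ^ℚ N) ℚ.*_) (sym (ℕ→ℚ-^ 6 N)))))

spread⇒code : ∀ p n r {C} → Spread p n r C → IsCode (2 + p) n (suc r) C
spread⇒code p n r = AllPairs.map (λ {x} {y} → far x y)
  where
  far : ∀ x y → near r x y ≡ false → suc r ≤ hamming x y
  far x y e = ≰⇒> λ d≤r → subst T e (≤⇒≤ᵇ d≤r)

theorem14 : (q n d : ℕ) → 2 ≤ q → 1 ≤ d → d ≤ n → 0ℚ ℚ.< e q n (d ∸ 1) →
    ∃[ C ] (IsCode q n d C ×
    (ℕ→ℚ (V q n (d ∸ 1)) ^ℚ (2 * q ^ n)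
    ℚ.≤ ℕ→ℚ (2 ^ (20 * length C * V q n (d ∸ 1))) ℚ.* (e q n (d ∸ 1) ^ℚ (q ^ n))))
theorem14 (suc (suc p)) n (suc r) _ _ _ 0<e =
  map₂ (λ {C} → λ (free , bound) → spread⇒code p n r free ,
      rational-bound D P (2 ^ (20 * length C * D)) ((2 + p) ^ n) (e (2 + p) n r) 6e≡P bound)
    (large-code p n r {{>-nonZero (m<n⇒0<n∸m D∸1<eSum)}})
  where
  D = V (2 + p) n r
  P = eSum (2 + p) n r ∸ (D ∸ 1)
  D∸1<eSum : D ∸ 1 < eSum (2 + p) n r
  -- The term of `V` for i = 0 computes to 1, so `V` unfolds to a successor and the integer
  -- difference in `e` computes to `D ∸ 1`.
  D∸1<eSum = 0<sixths⇒ (eSum (2 + p) n r) (D ∸ 1) 0<e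
  6e≡P : e (2 + p) n r ℚ.* ℕ→ℚ 6 ≡ ℕ→ℚ P
  6e≡P = subst (λ x → sixths x (D ∸ 1) ℚ.* ℕ→ℚ 6 ≡ ℕ→ℚ P) (m∸n+n≡m (<⇒≤ D∸1<eSum)) (6*sixths P (D ∸ 1))
theorem14 (suc zero) n d (s≤s ()) _ _ _
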